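{- Let $(K_n,P_n)_{n\ge 1}$ be a scaling with $\theta_n=(K_n,P_n)$ for which the limit $\lim_{n\to\infty}q(\theta_n)=q^\star$ exists. Suppose that either (i) $0\le q^\star<1$, or (ii) $q^\star=1$ and $\lim_{n\to\infty}n^3\,\tau(\theta_n)=\infty$. Then $$\lim_{n\to\infty}\mathbb{P}\left[\mathbb{K}(n;\theta_n)\text{ contains at least one triangle}\right]=1 .$$
   Context: Random key graph: for positive integers $K\le P$ write $\theta=(K,P)$, and let $K_1(\theta),\dots,K_n(\theta)$ be i.i.d. random subsets, each uniformly distributed over the $K$-element subsets of a fixed set of $P$ keys. The random key graph $\mathbb{K}(n;\theta)$ has vertex set $\{1,\dots,n\}$, and distinct nodes $i,j$ are adjacent iff $K_i(\theta)\cap K_j(\theta)\neq\emptyset$. Define $q(\theta)=0$ if $P<2K$ and $q(\theta)=\binom{P-K}{K}/\binom{P}{K}$ if $2K\le P$ (this is the probability that two given distinct nodes are not adjacent). Define $\tau(\theta)=\frac{K^3}{P^2}+\left(\frac{K^2}{P}\right)^3$. A scaling is a pair of sequences $K,P$ of positive integers, with values denoted $K_n,P_n$ ($n=1,2,\dots$), such that $K_n\le P_n$ for all $n=2,3,\dots$; one writes $\theta_n=(K_n,P_n)$. -}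

module Defs where

open import Data.Bool using (if_then_else_)
open import Data.Fin using (Fin)
open import Data.Fin.Properties using (any?) renaming (_≟_ to _≟ᶠ_)
open import Data.Fin.Subset using (Subset; inside; outside; _∩_; ∣_∣; Nonempty)
open import Data.Fin.Subset.Properties using (nonempty?)
open import Data.Integer using (+_)
open import Data.List using (List; []; _∷_; [_]; map; foldr; filter; length; cartesianProductWith)
open import Data.Nat as ℕ using (ℕ; zero; suc; _∸_; _^_)
import Data.Nat.Properties as ℕ
open import Data.Nat.Combinatorics using (_C_)
open import Data.Product using (_×_; _,_; ∃; ∃-syntax)
open import Data.Rational as ℚ using (ℚ; 0ℚ; 1ℚ; ½; _/_; _+_; _*_; -_; _-_)
import Data.Rational.Properties as ℚ
open import Data.Rational.Solver using (module +-*-Solver)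
open import Data.Sum using (inj₁; inj₂)
open import Data.Vec as Vec using (Vec; []; _∷_; lookup)
open import Level using (0ℓ)
open import Relation.Binary using (Rel) renaming (Decidable to Decidable₂)
open import Relation.Binary.PropositionalEquality using (_≡_; refl; sym; trans; cong; subst; subst₂)
open import Relation.Nullary using (does; ¬?; _×-dec_; ¬_)
open import Relation.Unary using (Pred; Decidable)

Eventually : Pred ℕ 0ℓ → Set
Eventually A = ∃[ N ] ∀ n → N ℕ.≤ n → A n

-- Reals as rational Cauchy sequences, equal up to _≃ᵣ_ below.
record ℝ : Set where
  constructor mkℝ
  field
    seq    : ℕ → ℚ
    cauchy : ∀ ε → 0ℚ ℚ.< ε →
             ∃[ N ] ∀ m n → N ℕ.≤ m → N ℕ.≤ n → ℚ.∣ seq m - seq n ∣ ℚ.< ε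

open ℝ public

infix 4 _<ᵣ_ _≤ᵣ_ _≃ᵣ_

_<ᵣ_ : Rel ℝ 0ℓ
x <ᵣ y = ∃[ ε ] 0ℚ ℚ.< ε × Eventually (λ n → ε ℚ.< seq y n - seq x n)

_≤ᵣ_ : Rel ℝ 0ℓ
x ≤ᵣ y = ∀ ε → 0ℚ ℚ.< ε → Eventually (λ n → seq x n - seq y n ℚ.< ε)

_≃ᵣ_ : Rel ℝ 0ℓ
x ≃ᵣ y = ∀ ε → 0ℚ ℚ.< ε → Eventually (λ n → ℚ.∣ seq x n - seq y n ∣ ℚ.< ε)

private
  half-pos : ∀ {ε} → 0ℚ ℚ.< ε → 0ℚ ℚ.< ½ * ε
  half-pos {ε} 0<ε =
    subst (ℚ._< ½ * ε) (ℚ.*-zeroʳ ½) (ℚ.*-monoʳ-<-pos ½ 0<ε)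

  halves : ∀ ε → ½ * ε + ½ * ε ≡ ε
  halves ε = trans (sym (ℚ.*-distribʳ-+ ε ½ ½)) (ℚ.*-identityˡ ε)

  interchange : ∀ a b c d → (a - b) - (c - d) ≡ (a - c) - (b - d)
  interchange = solve 4 (λ a b c d →
      (a :- b) :- (c :- d) := (a :- c) :- (b :- d)) refl
    where open +-*-Solver

  abs-≤ : ∀ {p r} → p ℚ.≤ r → - p ℚ.≤ r → ℚ.∣ p ∣ ℚ.≤ r
  abs-≤ {p} p≤r -p≤r with ℚ.∣p∣≡p∨∣p∣≡-p p
  ... | inj₁ eq = subst (ℚ._≤ _) (sym eq) p≤r
  ... | inj₂ eq = subst (ℚ._≤ _) (sym eq) -p≤r

  abs-diff : ∀ p r → ℚ.∣ p ∣ - ℚ.∣ r ∣ ℚ.≤ ℚ.∣ p - r ∣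
  abs-diff p r = subst (ℚ.∣ p ∣ - ℚ.∣ r ∣ ℚ.≤_) (cancel ℚ.∣ p - r ∣ ℚ.∣ r ∣)
    (ℚ.+-monoˡ-≤ (- ℚ.∣ r ∣)
      (subst (λ z → ℚ.∣ z ∣ ℚ.≤ ℚ.∣ p - r ∣ + ℚ.∣ r ∣) (add-back p r)
        (ℚ.∣p+q∣≤∣p∣+∣q∣ (p - r) r)))
    where
    open +-*-Solver
    cancel : ∀ a b → (a + b) - b ≡ a
    cancel = solve 2 (λ a b → (a :+ b) :- b := a) refl
    add-back : ∀ a b → (a - b) + b ≡ a
    add-back = solve 2 (λ a b → (a :- b) :+ b := a) refl

  neg-sub : ∀ a b → - (a - b) ≡ b - a
  neg-sub = solve 2 (λ a b → :- (a :- b) := b :- a) refl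
    where open +-*-Solver

  reverse-triangle : ∀ p r → ℚ.∣ ℚ.∣ p ∣ - ℚ.∣ r ∣ ∣ ℚ.≤ ℚ.∣ p - r ∣
  reverse-triangle p r = abs-≤ (abs-diff p r)
    (subst₂ ℚ._≤_ (sym (neg-sub ℚ.∣ p ∣ ℚ.∣ r ∣))
      (trans (cong ℚ.∣_∣ (sym (neg-sub p r))) (ℚ.∣-p∣≡∣p∣ (p - r)))
      (abs-diff r p))

fromℚ : ℚ → ℝ
fromℚ p = mkℝ (λ _ → p) λ ε 0<ε → 0 , λ _ _ _ _ →
  subst (λ z → ℚ.∣ z ∣ ℚ.< ε) (sym (ℚ.+-inverseʳ p)) 0<ε

0ᵣ 1ᵣ : ℝ
0ᵣ = fromℚ 0ℚ
1ᵣ = fromℚ 1ℚ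

infixl 6 _-ᵣ_

_-ᵣ_ : ℝ → ℝ → ℝ
x -ᵣ y = mkℝ (λ n → seq x n - seq y n) λ ε 0<ε →
  let (M , hx) = cauchy x (½ * ε) (half-pos 0<ε)
      (N , hy) = cauchy y (½ * ε) (half-pos 0<ε)
  in M ℕ.⊔ N , λ m n le le′ →
     subst (λ z → ℚ.∣ z ∣ ℚ.< ε)
       (interchange (seq x m) (seq x n) (seq y m) (seq y n))
       (ℚ.≤-<-trans
         (ℚ.∣p-q∣≤∣p∣+∣q∣ (seq x m - seq x n) (seq y m - seq y n))
         (subst (_ ℚ.<_) (halves ε)
           (ℚ.+-mono-<
             (hx m n (ℕ.m⊔n≤o⇒m≤o M N le) (ℕ.m⊔n≤o⇒m≤o M N le′))
             (hy m n (ℕ.m⊔n≤o⇒n≤o M N le) (ℕ.m⊔n≤o⇒n≤o M N le′)))))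

∣_∣ᵣ : ℝ → ℝ
∣ x ∣ᵣ = mkℝ (λ n → ℚ.∣ seq x n ∣) λ ε 0<ε →
  let (N , h) = cauchy x ε 0<ε
  in N , λ m n le le′ →
     ℚ.≤-<-trans (reverse-triangle (seq x m) (seq x n)) (h m n le le′)

infix 4 _⟶_ _⟶∞

-- Rational tolerances (and thresholds M below) suffice: ℚ is dense and
-- cofinal in the reals.
_⟶_ : (ℕ → ℚ) → ℝ → Set
a ⟶ x = ∀ ε → 0ℚ ℚ.< ε → Eventually (λ n → ∣ fromℚ (a n) -ᵣ x ∣ᵣ <ᵣ fromℚ ε)

_⟶∞ : (ℕ → ℚ) → Set
a ⟶∞ = ∀ M → Eventually (λ n → M ℚ.< a n)

-- Quotient of natural numbers as a rational, with the convention a ÷ 0 = 0.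
-- For a scaling, zero denominators can only arise at the indices 0 and 1.
infixl 7 _÷_

_÷_ : ℕ → ℕ → ℚ
a ÷ zero    = 0ℚ
a ÷ (suc b) = + a / suc b

q : (K P : ℕ) → ℚ
q K P = if does (2 ℕ.* K ℕ.≤? P)
        then ((P ∸ K) C K) ÷ (P C K)
        else 0ℚ

τ : (K P : ℕ) → ℚ
τ K P = (K ^ 3) ÷ (P ^ 2) + r * r * r
  where r = (K ^ 2) ÷ P

-- The sequences are indexed by n = 1, 2, …; their values at 0 are unconstrained.
record Scaling : Set where
  field
    K P        : ℕ → ℕ
    K-positive : ∀ n → 1 ℕ.≤ n → 1 ℕ.≤ K n
    P-positive : ∀ n → 1 ℕ.≤ n → 1 ℕ.≤ P n
    K≤P        : ∀ n → 2 ℕ.≤ n → K n ℕ.≤ P n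

-- All vectors of length n with entries drawn from a list.
vectors : ∀ {A : Set} → List A → (n : ℕ) → List (Vec A n)
vectors xs zero    = [ [] ]
vectors xs (suc n) = cartesianProductWith _∷_ xs (vectors xs n)

subsets : (P : ℕ) → List (Subset P)
subsets = vectors (inside ∷ outside ∷ [])

-- Probability mass function of the uniform law on the K-element subsets of
-- the P keys.
uniformMass : (K P : ℕ) → Subset P → ℚ
uniformMass K P S =
  if does (∣ S ∣ ℕ.≟ K)
  then 1 ÷ length (filter (λ T → ∣ T ∣ ℕ.≟ K) (subsets P))
  else 0ℚ

-- An outcome assigns a key ring to each of the n nodes.
Outcome : (n P : ℕ) → Set
Outcome n P = Vec (Subset P) n

-- Independence: the joint law of the key rings is the product law.
mass : (n K P : ℕ) → Outcome n P → ℚ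
mass n K P ω = Vec.foldr′ _*_ 1ℚ (Vec.map (uniformMass K P) ω)

ℙ : (n K P : ℕ) {A : Pred (Outcome n P) 0ℓ} → Decidable A → ℚ
ℙ n K P A? = foldr _+_ 0ℚ (map (mass n K P) (filter A? (vectors (subsets P) n)))

Adjacent : ∀ {n P} → Outcome n P → Rel (Fin n) 0ℓ
Adjacent ω i j = ¬ (i ≡ j) × Nonempty (lookup ω i ∩ lookup ω j)

adjacent? : ∀ {n P} (ω : Outcome n P) → Decidable₂ (Adjacent ω)
adjacent? ω i j = ¬? (i ≟ᶠ j) ×-dec nonempty? (lookup ω i ∩ lookup ω j)

-- Adjacent nodes are distinct, so i, j, k are pairwise distinct.
HasTriangle : ∀ {n P} → Outcome n P → Set
HasTriangle ω =
  ∃[ i ] ∃[ j ] ∃[ k ] Adjacent ω i j × Adjacent ω j k × Adjacent ω i k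

hasTriangle? : ∀ {n P} → Decidable (HasTriangle {n} {P})
hasTriangle? ω = any? λ i → any? λ j → any? λ k →
  adjacent? ω i j ×-dec adjacent? ω j k ×-dec adjacent? ω i k

ℙ[triangle] : (n K P : ℕ) → ℚ
ℙ[triangle] n K P = ℙ n K P hasTriangle?

module Submission where

-- Second moment method.  Split the nodes into three blocks of m = ⌊n/3⌋ nodes
-- and count the triangles T with one node in each block.  Let p = 1 - q and let
-- β be the probability of a triangle on three given nodes.  By inclusion-exclusion
-- that probability is unchanged when one of the key rings is prescribed, so pairs
-- of triples sharing a single node are uncorrelated; for pairs sharing two nodes
-- the joint probability is at most p β.  Hence
--   (1 - ℙ[triangle]) (m³β)² ≤ 𝔼 (T - m³β)² ≤ m³β + 3 m⁴pβ + 3 m⁵β²,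
-- and it suffices that m, m²β/p and m³β tend to infinity.  This follows from
-- β ≥ p³, β ≥ p K/P and p ≥ x/(1 + x), where x = K²/P.

open import Defs
open import Data.Bool using (Bool; true; false; _∧_; if_then_else_)
open import Data.Empty using (⊥-elim)
open import Data.Fin as Fin using (Fin; _↑ˡ_; _↑ʳ_)
import Data.Fin.Properties as Fin
open import Data.Fin.Subset as Subset using (Subset; inside; outside; _∩_; _∪_; ∣_∣; Nonempty)
open import Data.Fin.Subset.Properties using (∣p∣≤n; ∣⊥∣≡0)
open import Data.Integer as ℤ using (-[1+_])
import Data.Integer.Properties as ℤ
open import Data.List as List using (List; []; _∷_; foldr; map; filter; length; cartesianProductWith)
open import Data.Nat as ℕ using (ℕ; zero; suc; _∸_; _^_; _!; z≤n; s≤s)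
open import Data.Nat.Combinatorics using (_C_; nPk≡n!/[n∸k]!; nCk≡nPk/k!; k>n⇒nCk≡0; nCk+nC[k+1]≡[n+1]C[k+1])
open import Data.Nat.Combinatorics.Base using (_P′_)
open import Data.Nat.Combinatorics.Specification using (nP′k≡n!/[n∸k]!; nP′k≡n[n∸1P′k∸1]; k!∣nP′k)
import Data.Nat.DivMod as ℕ
import Data.Nat.Properties as ℕ
import Data.Nat.Solver as ℕ
open import Data.Product using (_×_; _,_; ∃-syntax; proj₁; proj₂)
open import Data.Rational as ℚ using (ℚ; 0ℚ; 1ℚ; ½; _/_; _+_; _*_; -_; _-_; _≤_; _<_)
import Data.Rational.Properties as ℚ
import Data.Rational.Solver as ℚ
open import Data.Rational.Unnormalised as ℚᵘ using (mkℚᵘ; *≡*; *≤*)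
import Data.Rational.Unnormalised.Properties as ℚᵘ
open import Data.Sum using (_⊎_; inj₁; inj₂)
open import Data.Unit using (⊤; tt)
open import Data.Vec as Vec using (Vec; []; _∷_; lookup; here; there)
open import Data.Vec.Properties using (lookup-++ˡ; lookup-++ʳ)
open import Function using (_∘_; case_of_)
open import Level using (0ℓ)
open import Relation.Binary.PropositionalEquality
open import Relation.Nullary using (yes; no; ¬_; does)
open import Relation.Nullary.Decidable using (dec-true; dec-false)
open import Relation.Unary using (Pred; Decidable)

-- The two lower bounds on β mirror the two terms of τ. With y = K/P one has τ = x y + x³; β ≥ p y
-- matches x y (heuristically, one key held by all three nodes) and β ≥ p³ matches x³ (three pairs
-- meeting separately). Once p ≤ 1/2, the bound p ≥ x/(1 + x) gives p ≥ x/2, so β is at least a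
-- constant multiple of τ, and this is how n³τ → ∞ enters. If q⋆ < 1, p stays away from 0 and β ≥ p³
-- alone suffices. Blocks are used instead of unordered triples because T then depends on three
-- independent vectors of rings: nodes of different blocks are distinct without bookkeeping, and the
-- second moment can be bounded one block at a time. Only a constant factor is lost. Divisions are
-- avoided throughout: m²β/p → ∞ takes the form `L * p ≤ μ * μ * β` for every fixed `L` and all
-- large n.

private
  module R = ℚ.+-*-Solver
  module S = ℕ.+-*-Solver

-- Abstract because unfolding the normalisation in _/_ defeats unification.
abstract
  ι : ℕ → ℚ
  ι n = ℤ.+ n / 1

  ιᵘ : ∀ n → ℚ.toℚᵘ (ι n) ℚᵘ.≃ mkℚᵘ (ℤ.+ n) 0
  ιᵘ n = ℚ.toℚᵘ-fromℚᵘ (mkℚᵘ (ℤ.+ n) 0)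

  ι-+ : ∀ m n → ι (m ℕ.+ n) ≡ ι m + ι n
  ι-+ m n = ℚ.toℚᵘ-injective (begin
    ℚ.toℚᵘ (ι (m ℕ.+ n))                ≈⟨ ιᵘ (m ℕ.+ n) ⟩
    mkℚᵘ (ℤ.+ (m ℕ.+ n)) 0                ≈⟨ *≡* (cong (ℤ._* ℤ.+ 1) (cong₂ ℤ._+_ (sym (ℤ.*-identityʳ (ℤ.+ m))) (sym (ℤ.*-identityʳ (ℤ.+ n))))) ⟩
    mkℚᵘ (ℤ.+ m) 0 ℚᵘ.+ mkℚᵘ (ℤ.+ n) 0      ≈⟨ ℚᵘ.+-cong (ιᵘ m) (ιᵘ n) ⟨
    ℚ.toℚᵘ (ι m) ℚᵘ.+ ℚ.toℚᵘ (ι n)      ≈⟨ ℚ.toℚᵘ-homo-+ (ι m) (ι n) ⟨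
    ℚ.toℚᵘ (ι m + ι n)                  ∎)
    where open ℚᵘ.≃-Reasoning

  ι-* : ∀ m n → ι (m ℕ.* n) ≡ ι m * ι n
  ι-* m n = ℚ.toℚᵘ-injective (begin
    ℚ.toℚᵘ (ι (m ℕ.* n))                ≈⟨ ιᵘ (m ℕ.* n) ⟩
    mkℚᵘ (ℤ.+ (m ℕ.* n)) 0                ≈⟨ *≡* (cong (ℤ._* ℤ.+ 1) (ℤ.pos-* m n)) ⟩
    mkℚᵘ (ℤ.+ m) 0 ℚᵘ.* mkℚᵘ (ℤ.+ n) 0      ≈⟨ ℚᵘ.*-cong (ιᵘ m) (ιᵘ n) ⟨
    ℚ.toℚᵘ (ι m) ℚᵘ.* ℚ.toℚᵘ (ι n)      ≈⟨ ℚ.toℚᵘ-homo-* (ι m) (ι n) ⟨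
    ℚ.toℚᵘ (ι m * ι n)                  ∎)
    where open ℚᵘ.≃-Reasoning

  ι-mono-≤ : ∀ {m n} → m ℕ.≤ n → ι m ≤ ι n
  ι-mono-≤ {m} {n} m≤n = ℚ.toℚᵘ-cancel-≤
    (ℚᵘ.≤-respˡ-≃ (ℚᵘ.≃-sym (ιᵘ m)) (ℚᵘ.≤-respʳ-≃ (ℚᵘ.≃-sym (ιᵘ n))
      (*≤* (ℤ.*-monoʳ-≤-nonNeg (ℤ.+ 1) (ℤ.+≤+ m≤n)))))

  ÷-* : ∀ a {b} → 1 ℕ.≤ b → (a ÷ b) * ι b ≡ ι a
  ÷-* a {suc b} _ = ℚ.toℚᵘ-injective (begin
    ℚ.toℚᵘ ((a ÷ suc b) * ι (suc b))           ≈⟨ ℚ.toℚᵘ-homo-* (a ÷ suc b) (ι (suc b)) ⟩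
    ℚ.toℚᵘ (a ÷ suc b) ℚᵘ.* ℚ.toℚᵘ (ι (suc b)) ≈⟨ ℚᵘ.*-cong (ℚ.toℚᵘ-fromℚᵘ (mkℚᵘ (ℤ.+ a) b)) (ιᵘ (suc b)) ⟩
    mkℚᵘ (ℤ.+ a) b ℚᵘ.* mkℚᵘ (ℤ.+ suc b) 0         ≈⟨ *≡* (trans (ℤ.*-identityʳ (ℤ.+ a ℤ.* ℤ.+ suc b))
                                                    (cong (λ d → ℤ.+ a ℤ.* ℤ.+ d) (sym (ℕ.*-identityʳ (suc b))))) ⟩
    mkℚᵘ (ℤ.+ a) 0                               ≈⟨ ιᵘ a ⟨
    ℚ.toℚᵘ (ι a)                               ∎)
    where open ℚᵘ.≃-Reasoning

  -- The denominator is at least 1, so the absolute value of the numerator serves as the bound.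
  archimedean : ∀ p → ∃[ N ] p ≤ ι N
  archimedean p = ℤ.∣ ℚ.↥ p ∣ , ℚ.toℚᵘ-cancel-≤ (ℚᵘ.≤-respʳ-≃ (ℚᵘ.≃-sym (ιᵘ ℤ.∣ ℚ.↥ p ∣)) (bound p))
    where
    bound : ∀ p → ℚ.toℚᵘ p ℚᵘ.≤ mkℚᵘ (ℤ.+ ℤ.∣ ℚ.↥ p ∣) 0
    bound (ℚ.mkℚ (ℤ.+ n) d _) = *≤* (subst₂ ℤ._≤_ (ℤ.pos-* n 1) (ℤ.pos-* n (suc d))
      (ℤ.+≤+ (ℕ.*-monoʳ-≤ n (s≤s z≤n))))
    bound (ℚ.mkℚ (-[1+ n ]) d _) = *≤* ℤ.-≤+

  ÷1≡ι : ∀ n → n ÷ 1 ≡ ι n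
  ÷1≡ι n = refl

ι-0 : ι 0 ≡ 0ℚ
ι-0 = sym (÷1≡ι 0)

ι-1 : ι 1 ≡ 1ℚ
ι-1 = sym (÷1≡ι 1)

-- Sign and monotonicity rules for rational arithmetic

0≤ι : ∀ n → 0ℚ ≤ ι n
0≤ι n = subst (_≤ ι n) ι-0 (ι-mono-≤ z≤n)

1≤ι : ∀ {n} → 1 ℕ.≤ n → 1ℚ ≤ ι n
1≤ι {n} 1≤n = subst (_≤ ι n) ι-1 (ι-mono-≤ 1≤n)

0<ι : ∀ {n} → 1 ℕ.≤ n → 0ℚ < ι n
0<ι 1≤n = ℚ.<-≤-trans (ℚ.positive⁻¹ 1ℚ) (1≤ι 1≤n)

0≤+ : ∀ {a b} → 0ℚ ≤ a → 0ℚ ≤ b → 0ℚ ≤ a + b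
0≤+ = ℚ.+-mono-≤

0≤* : ∀ {a b} → 0ℚ ≤ a → 0ℚ ≤ b → 0ℚ ≤ a * b
0≤* {a} {b} 0≤a 0≤b = subst (_≤ a * b) (ℚ.*-zeroʳ a)
  (ℚ.*-monoˡ-≤-nonNeg a {{ℚ.nonNegative 0≤a}} 0≤b)

0<* : ∀ {a b} → 0ℚ < a → 0ℚ < b → 0ℚ < a * b
0<* {a} {b} 0<a 0<b = subst (_< a * b) (ℚ.*-zeroʳ a)
  (ℚ.*-monoʳ-<-pos a {{ℚ.positive 0<a}} 0<b)

≤⇒0≤ : ∀ {a b} → a ≤ b → 0ℚ ≤ b - a
≤⇒0≤ {a} {b} a≤b = subst (_≤ b - a) (ℚ.+-inverseʳ a) (ℚ.+-monoˡ-≤ (- a) a≤b)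

0≤⇒≤ : ∀ {a b} → 0ℚ ≤ b - a → a ≤ b
0≤⇒≤ {a} {b} 0≤b-a = subst₂ _≤_ (ℚ.+-identityˡ a) (back a b) (ℚ.+-monoˡ-≤ a 0≤b-a)
  where
  back : ∀ a b → (b - a) + a ≡ b
  back = R.solve 2 (λ a b → (b R.:- a) R.:+ a R.:= b) refl

-- To prove a ≤ b, exhibit b - a as a combination of nonnegative quantities.
≤-by : ∀ {a b d} → 0ℚ ≤ d → d ≡ b - a → a ≤ b
≤-by 0≤d eq = 0≤⇒≤ (subst (0ℚ ≤_) eq 0≤d)

*-mono-≤ : ∀ {a b c d} → 0ℚ ≤ a → 0ℚ ≤ d → a ≤ b → c ≤ d → a * c ≤ b * d
*-mono-≤ {a} {b} {c} {d} 0≤a 0≤d a≤b c≤d = ℚ.≤-trans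
  (ℚ.*-monoˡ-≤-nonNeg a {{ℚ.nonNegative 0≤a}} c≤d)
  (ℚ.*-monoʳ-≤-nonNeg d {{ℚ.nonNegative 0≤d}} a≤b)

cancel-≤ : ∀ {a b} c → 0ℚ < c → a * c ≤ b * c → a ≤ b
cancel-≤ c 0<c = ℚ.*-cancelʳ-≤-pos c {{ℚ.positive 0<c}}

cancel-≡ : ∀ {a b} c → 0ℚ < c → a * c ≡ b * c → a ≡ b
cancel-≡ c 0<c eq = ℚ.≤-antisym (cancel-≤ c 0<c (ℚ.≤-reflexive eq)) (cancel-≤ c 0<c (ℚ.≤-reflexive (sym eq)))

square≥0 : ∀ a → 0ℚ ≤ a * a
square≥0 a = subst (0ℚ ≤_) (trans (sym (ℚ.∣p*q∣≡∣p∣*∣q∣ a a)) (lemma a)) (0≤* (ℚ.0≤∣p∣ a) (ℚ.0≤∣p∣ a))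
  where
  lemma : ∀ a → ℚ.∣ a * a ∣ ≡ a * a
  lemma a with ℚ.∣p∣≡p∨∣p∣≡-p a
  ... | inj₁ eq = trans (ℚ.∣p*q∣≡∣p∣*∣q∣ a a) (cong₂ _*_ eq eq)
  ... | inj₂ eq = trans (ℚ.∣p*q∣≡∣p∣*∣q∣ a a) (trans (cong₂ _*_ eq eq)
    (R.solve 1 (λ a → (R.:- a) R.:* (R.:- a) R.:= a R.:* a) refl a))

-- Falling factorials and binomial coefficients

P′-above : ∀ {n k} → n ℕ.< k → n P′ k ≡ 0
P′-above {n} {suc k} (s≤s n≤k) = cong (ℕ._* (n P′ k)) (ℕ.m≤n⇒m∸n≡0 n≤k)

-- Reduces comparisons of binomials with equal lower index to falling factorials, whose product
-- recursion in `k` allows induction factor by factor. Beyond `k ≤ n` both sides vanish, so no bound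
-- on `k` has to be carried.
C-*-! : ∀ n k → (n C k) ℕ.* (k !) ≡ n P′ k
C-*-! n k with k ℕ.≤? n
... | yes k≤n = trans (cong (ℕ._* (k !)) (trans (nCk≡nPk/k! k≤n)
        (ℕ./-congˡ (trans (nPk≡n!/[n∸k]! k≤n) (sym (nP′k≡n!/[n∸k]! k≤n))))))
        (ℕ.m/n*n≡m (k!∣nP′k k≤n))
  where instance _ = ℕ._!≢0 k
                 _ = ℕ._!≢0 (n ∸ k)
... | no  k≰n = trans (cong (ℕ._* (k !)) (k>n⇒nCk≡0 (ℕ.≰⇒> k≰n))) (sym (P′-above (ℕ.≰⇒> k≰n)))

P′-positive : ∀ n k → k ℕ.≤ n → 1 ℕ.≤ n P′ k
P′-positive n zero    _   = s≤s z≤n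
P′-positive n (suc k) k<n = ℕ.*-mono-≤ (ℕ.m<n⇒0<n∸m k<n) (P′-positive n k (ℕ.<⇒≤ k<n))

C-positive : ∀ n k → k ℕ.≤ n → 1 ℕ.≤ n C k
C-positive n k k≤n = ℕ.n≢0⇒n>0 λ nCk≡0 → ℕ.<⇒≢ (P′-positive n k k≤n)
  (sym (trans (sym (C-*-! n k)) (cong (ℕ._* (k !)) nCk≡0)))

∸-swap : ∀ a b c → a ∸ b ∸ c ≡ a ∸ c ∸ b
∸-swap a b c = trans (ℕ.∸-+-assoc a b c) (trans (cong (a ∸_) (ℕ.+-comm b c)) (sym (ℕ.∸-+-assoc a c b)))

-- If 2s exceeds c, the truncated difference on the left is 0. Otherwise c = 2s + d and the two
-- sides differ by exactly s².
∸-log-concave : ∀ c s → (c ∸ (s ℕ.+ s)) ℕ.* c ℕ.≤ (c ∸ s) ℕ.* (c ∸ s)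
∸-log-concave c s with s ℕ.+ s ℕ.≤? c
... | no  2s≰c rewrite ℕ.m≤n⇒m∸n≡0 (ℕ.<⇒≤ (ℕ.≰⇒> 2s≰c)) = z≤n
... | yes 2s≤c with d , refl ← ℕ.m≤n⇒∃[o]m+o≡n 2s≤c
  rewrite ℕ.m+n∸m≡n (s ℕ.+ s) d | ℕ.+-assoc s s d | ℕ.m+n∸m≡n s (s ℕ.+ d)
  = subst (d ℕ.* (s ℕ.+ (s ℕ.+ d)) ℕ.≤_) (eq s d) (ℕ.m≤m+n _ (s ℕ.* s))
  where
  eq : ∀ s d → d ℕ.* (s ℕ.+ (s ℕ.+ d)) ℕ.+ s ℕ.* s ≡ (s ℕ.+ d) ℕ.* (s ℕ.+ d)
  eq = S.solve 2 (λ s d → d S.:* (s S.:+ (s S.:+ d)) S.:+ s S.:* s S.:= (s S.:+ d) S.:* (s S.:+ d)) refl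

interchange : ∀ a b c d → (a ℕ.* b) ℕ.* (c ℕ.* d) ≡ (a ℕ.* c) ℕ.* (b ℕ.* d)
interchange = S.solve 4 (λ a b c d → (a S.:* b) S.:* (c S.:* d) S.:= (a S.:* c) S.:* (b S.:* d)) refl

P′-log-concave : ∀ n s k → ((n ∸ (s ℕ.+ s)) P′ k) ℕ.* (n P′ k) ℕ.≤ ((n ∸ s) P′ k) ℕ.* ((n ∸ s) P′ k)
P′-log-concave n s zero    = ℕ.≤-refl
P′-log-concave n s (suc k)
  rewrite ∸-swap n (s ℕ.+ s) k | ∸-swap n s k
        | interchange (n ∸ k ∸ (s ℕ.+ s)) ((n ∸ (s ℕ.+ s)) P′ k) (n ∸ k) (n P′ k)
        | interchange (n ∸ k ∸ s) ((n ∸ s) P′ k) (n ∸ k ∸ s) ((n ∸ s) P′ k)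
  = ℕ.*-mono-≤ (∸-log-concave (n ∸ k) s) (P′-log-concave n s k)

-- For `s` = `k` = K this becomes `r≤Q²`: missing two disjoint rings at once is at most as likely as
-- two independent misses.
C-log-concave : ∀ n s k → ((n ∸ (s ℕ.+ s)) C k) ℕ.* (n C k) ℕ.≤ ((n ∸ s) C k) ℕ.* ((n ∸ s) C k)
C-log-concave n s k = ℕ.*-cancelʳ-≤ _ _ (k ! ℕ.* k !) (subst₂ ℕ._≤_
  (trans (cong₂ ℕ._*_ (sym (C-*-! (n ∸ (s ℕ.+ s)) k)) (sym (C-*-! n k))) (interchange ((n ∸ (s ℕ.+ s)) C k) (k !) (n C k) (k !)))
  (trans (cong₂ ℕ._*_ (sym (C-*-! (n ∸ s) k)) (sym (C-*-! (n ∸ s) k))) (interchange ((n ∸ s) C k) (k !) ((n ∸ s) C k) (k !)))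
  (P′-log-concave n s k))
  where instance _ = ℕ._!≢0 k
                 _ = ℕ.m*n≢0 (k !) (k !)

-- One factor of a telescoping product: (n - s - k)/(n - k) ≤ (n + ks)/(n + (k + 1)s). Multiplying
-- the first k of these leaves n/(n + ks).
P′-decay-step : ∀ n s k → (n ∸ s ∸ k) ℕ.* (n ℕ.+ (s ℕ.+ k ℕ.* s)) ℕ.≤ (n ∸ k) ℕ.* (n ℕ.+ k ℕ.* s)
P′-decay-step n s k with s ℕ.+ k ℕ.≤? n
... | no  ≰n rewrite ℕ.∸-+-assoc n s k | ℕ.m≤n⇒m∸n≡0 (ℕ.<⇒≤ (ℕ.≰⇒> ≰n)) = z≤n
... | yes ≤n with d , refl ← ℕ.m≤n⇒∃[o]m+o≡n ≤n
  rewrite ℕ.∸-+-assoc (s ℕ.+ k ℕ.+ d) s k | ℕ.m+n∸m≡n (s ℕ.+ k) d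
        | ℕ.+-comm s k | ℕ.+-assoc k s d | ℕ.m+n∸m≡n k (s ℕ.+ d)
  = subst (d ℕ.* (k ℕ.+ (s ℕ.+ d) ℕ.+ (s ℕ.+ k ℕ.* s)) ℕ.≤_) (eq s k d)
      (ℕ.m≤m+n _ (s ℕ.* (k ℕ.+ s ℕ.+ k ℕ.* s)))
  where
  eq : ∀ s k d → d ℕ.* (k ℕ.+ (s ℕ.+ d) ℕ.+ (s ℕ.+ k ℕ.* s)) ℕ.+ s ℕ.* (k ℕ.+ s ℕ.+ k ℕ.* s)
               ≡ (s ℕ.+ d) ℕ.* (k ℕ.+ (s ℕ.+ d) ℕ.+ k ℕ.* s)
  eq = S.solve 3 (λ s k d → d S.:* (k S.:+ (s S.:+ d) S.:+ (s S.:+ k S.:* s)) S.:+ s S.:* (k S.:+ s S.:+ k S.:* s)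
               S.:= (s S.:+ d) S.:* (k S.:+ (s S.:+ d) S.:+ k S.:* s)) refl

P′-decay : ∀ n s k → (n ℕ.+ k ℕ.* s) ℕ.* ((n ∸ s) P′ k) ℕ.≤ n ℕ.* (n P′ k)
P′-decay n s zero    = ℕ.≤-reflexive (cong (ℕ._* 1) (ℕ.+-identityʳ n))
P′-decay n s (suc k) = begin
  (n ℕ.+ (s ℕ.+ k ℕ.* s)) ℕ.* ((n ∸ s ∸ k) ℕ.* ((n ∸ s) P′ k))  ≡⟨ eq (n ℕ.+ (s ℕ.+ k ℕ.* s)) (n ∸ s ∸ k) _ ⟩
  (n ∸ s ∸ k) ℕ.* (n ℕ.+ (s ℕ.+ k ℕ.* s)) ℕ.* ((n ∸ s) P′ k)    ≤⟨ ℕ.*-monoˡ-≤ _ (P′-decay-step n s k) ⟩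
  (n ∸ k) ℕ.* (n ℕ.+ k ℕ.* s) ℕ.* ((n ∸ s) P′ k)                ≡⟨ ℕ.*-assoc (n ∸ k) (n ℕ.+ k ℕ.* s) _ ⟩
  (n ∸ k) ℕ.* ((n ℕ.+ k ℕ.* s) ℕ.* ((n ∸ s) P′ k))              ≤⟨ ℕ.*-monoʳ-≤ (n ∸ k) (P′-decay n s k) ⟩
  (n ∸ k) ℕ.* (n ℕ.* (n P′ k))                                  ≡⟨ swap (n ∸ k) n (n P′ k) ⟩
  n ℕ.* ((n ∸ k) ℕ.* (n P′ k))                                  ∎
  where
  open ℕ.≤-Reasoning
  eq : ∀ a b c → a ℕ.* (b ℕ.* c) ≡ b ℕ.* a ℕ.* c
  eq = S.solve 3 (λ a b c → a S.:* (b S.:* c) S.:= b S.:* a S.:* c) refl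
  swap : ∀ a b c → a ℕ.* (b ℕ.* c) ≡ b ℕ.* (a ℕ.* c)
  swap = S.solve 3 (λ a b c → a S.:* (b S.:* c) S.:= b S.:* (a S.:* c)) refl

-- For `s` = `k` = K and n = P it reads q ≤ P/(P + K²) = 1/(1 + x), which is the source of p ≥ x/(1
-- + x).
C-decay : ∀ n s k → (n ℕ.+ k ℕ.* s) ℕ.* ((n ∸ s) C k) ℕ.≤ n ℕ.* (n C k)
C-decay n s k = ℕ.*-cancelʳ-≤ _ _ (k !) (subst₂ ℕ._≤_
  (trans (cong ((n ℕ.+ k ℕ.* s) ℕ.*_) (sym (C-*-! (n ∸ s) k))) (sym (ℕ.*-assoc (n ℕ.+ k ℕ.* s) _ _)))
  (trans (cong (n ℕ.*_) (sym (C-*-! n k))) (sym (ℕ.*-assoc n _ _)))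
  (P′-decay n s k))
  where instance _ = ℕ._!≢0 k

-- Serves to compute the probability that a ring avoids one given key as (P - K)/P; see `φ1`.
C-absorb : ∀ n k → 1 ℕ.≤ n → ((n ∸ 1) C k) ℕ.* n ≡ (n C k) ℕ.* (n ∸ k)
C-absorb n@(suc n-1) k _ = ℕ.*-cancelʳ-≡ _ _ (k !) (begin
  (n-1 C k) ℕ.* n ℕ.* (k !)        ≡⟨ swap (n-1 C k) n (k !) ⟩
  n ℕ.* ((n-1 C k) ℕ.* (k !))      ≡⟨ cong (n ℕ.*_) (C-*-! n-1 k) ⟩
  n ℕ.* (n-1 P′ k)                 ≡⟨ nP′k≡n[n∸1P′k∸1] n (suc k) ⟨
  (n ∸ k) ℕ.* (n P′ k)             ≡⟨ cong ((n ∸ k) ℕ.*_) (C-*-! n k) ⟨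
  (n ∸ k) ℕ.* ((n C k) ℕ.* (k !))  ≡⟨ back (n ∸ k) (n C k) (k !) ⟩
  (n C k) ℕ.* (n ∸ k) ℕ.* (k !)    ∎)
  where
  open ≡-Reasoning
  instance _ = ℕ._!≢0 k
  swap : ∀ a b c → a ℕ.* b ℕ.* c ≡ b ℕ.* (a ℕ.* c)
  swap = S.solve 3 (λ a b c → a S.:* b S.:* c S.:= b S.:* (a S.:* c)) refl
  back : ∀ a b c → a ℕ.* (b ℕ.* c) ≡ b ℕ.* a ℕ.* c
  back = S.solve 3 (λ a b c → a S.:* (b S.:* c) S.:= b S.:* a S.:* c) refl

-- Expectations as linear functionals

private
  variable
    A B : Set

-- Pointwise equal functions are not propositionally equal here, so respecting pointwise equality is
-- a field of its own.
record IsLinear (L : (A → ℚ) → ℚ) : Set where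
  field
    cong-≗ : ∀ {f g} → (∀ x → f x ≡ g x) → L f ≡ L g
    add    : ∀ f g → L (λ x → f x + g x) ≡ L f + L g
    scale  : ∀ c f → L (λ x → c * f x) ≡ c * L f

  zeros : L (λ _ → 0ℚ) ≡ 0ℚ
  zeros = trans (scale 0ℚ (λ _ → 0ℚ)) (ℚ.*-zeroˡ (L (λ _ → 0ℚ)))

-- Independence becomes nesting of functionals. `Support` records what holds wherever the mass is
-- nonzero (for key rings, having exactly K keys), so `mono` compares functions only there. `fubini`
-- ranges over all linear functionals, hence covers interchange with single rings and with whole
-- blocks alike.
record Expectation (A : Set) : Set₁ where
  field
    𝔼       : (A → ℚ) → ℚ
    Support : A → Set
    mono    : ∀ {f g} → (∀ x → Support x → f x ≤ g x) → 𝔼 f ≤ 𝔼 g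
    add     : ∀ f g → 𝔼 (λ x → f x + g x) ≡ 𝔼 f + 𝔼 g
    scale   : ∀ c f → 𝔼 (λ x → c * f x) ≡ c * 𝔼 f
    total   : 𝔼 (λ _ → 1ℚ) ≡ 1ℚ
    fubini  : ∀ {B} {L : (B → ℚ) → ℚ} → IsLinear L → ∀ (f : A → B → ℚ) →
              L (λ b → 𝔼 (λ a → f a b)) ≡ 𝔼 (λ a → L (f a))

  cong-on : ∀ {f g} → (∀ x → Support x → f x ≡ g x) → 𝔼 f ≡ 𝔼 g
  cong-on eq = ℚ.≤-antisym (mono λ x s → ℚ.≤-reflexive (eq x s)) (mono λ x s → ℚ.≤-reflexive (sym (eq x s)))

  ext : ∀ {f g} → (∀ x → f x ≡ g x) → 𝔼 f ≡ 𝔼 g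
  ext eq = cong-on (λ x _ → eq x)

  constant : ∀ c → 𝔼 (λ _ → c) ≡ c
  constant c = trans (ext (λ _ → sym (ℚ.*-identityʳ c)))
    (trans (scale c _) (trans (cong (c *_) total) (ℚ.*-identityʳ c)))

  linear : IsLinear 𝔼
  linear = record { cong-≗ = ext ; add = add ; scale = scale }

  nonNegative : ∀ {f} → (∀ x → Support x → 0ℚ ≤ f x) → 0ℚ ≤ 𝔼 f
  nonNegative {f} 0≤f = subst (_≤ 𝔼 f) (constant 0ℚ) (mono 0≤f)

  subtract : ∀ f g → 𝔼 (λ x → f x - g x) ≡ 𝔼 f - 𝔼 g
  subtract f g = trans (ext λ x → cong (f x +_) (R.solve 1 (λ a → R.:- a R.:= R.con (- 1ℚ) R.:* a) refl (g x)))
    (trans (add f _) (cong (𝔼 f +_) (trans (scale (- 1ℚ) g)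
      (R.solve 1 (λ a → R.con (- 1ℚ) R.:* a R.:= R.:- a) refl (𝔼 g)))))

∑ : List A → (A → ℚ) → ℚ
∑ xs f = foldr _+_ 0ℚ (map f xs)

∑-linear : (xs : List A) → IsLinear (∑ xs)
∑-linear xs = record { cong-≗ = cong-≗ xs ; add = add xs ; scale = scale xs }
  where
  cong-≗ : (xs : List A) → ∀ {f g} → (∀ x → f x ≡ g x) → ∑ xs f ≡ ∑ xs g
  cong-≗ []       eq = refl
  cong-≗ (x ∷ xs) eq = cong₂ _+_ (eq x) (cong-≗ xs eq)
  add : (xs : List A) → ∀ f g → ∑ xs (λ x → f x + g x) ≡ ∑ xs f + ∑ xs g
  add []       f g = refl
  add (x ∷ xs) f g = trans (cong (f x + g x +_) (add xs f g))
    (R.solve 4 (λ a b c d → (a R.:+ b) R.:+ (c R.:+ d) R.:= (a R.:+ c) R.:+ (b R.:+ d)) refl (f x) (g x) _ _)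
  scale : (xs : List A) → ∀ c f → ∑ xs (λ x → c * f x) ≡ c * ∑ xs f
  scale []       c f = sym (ℚ.*-zeroʳ c)
  scale (x ∷ xs) c f = trans (cong (c * f x +_) (scale xs c f)) (sym (ℚ.*-distribˡ-+ c (f x) _))

module ∑ {A} (xs : List A) = IsLinear (∑-linear xs)

∑-mono : (xs : List A) → ∀ {f g} → (∀ x → f x ≤ g x) → ∑ xs f ≤ ∑ xs g
∑-mono []       f≤g = ℚ.≤-refl
∑-mono (x ∷ xs) f≤g = ℚ.+-mono-≤ (f≤g x) (∑-mono xs f≤g)

∑-++ : (xs ys : List A) → ∀ f → ∑ (xs List.++ ys) f ≡ ∑ xs f + ∑ ys f
∑-++ []       ys f = sym (ℚ.+-identityˡ _)
∑-++ (x ∷ xs) ys f = trans (cong (f x +_) (∑-++ xs ys f)) (sym (ℚ.+-assoc (f x) _ _))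

∑-map : (h : A → B) (xs : List A) → ∀ f → ∑ (map h xs) f ≡ ∑ xs (f ∘ h)
∑-map h []       f = refl
∑-map h (x ∷ xs) f = cong (f (h x) +_) (∑-map h xs f)

∑-cartesianProductWith : ∀ {C : Set} (h : A → B → C) xs ys f →
  ∑ (cartesianProductWith h xs ys) f ≡ ∑ xs (λ x → ∑ ys (λ y → f (h x y)))
∑-cartesianProductWith h []       ys f = refl
∑-cartesianProductWith h (x ∷ xs) ys f = trans (∑-++ (map (h x) ys) _ f)
  (cong₂ _+_ (∑-map (h x) ys f) (∑-cartesianProductWith h xs ys f))

𝟙 : Bool → ℚ
𝟙 true  = 1ℚ
𝟙 false = 0ℚ

0≤1ℚ : 0ℚ ≤ 1ℚ
0≤1ℚ = ℚ.nonNegative⁻¹ 1ℚ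

0≤𝟙 : ∀ b → 0ℚ ≤ 𝟙 b
0≤𝟙 true  = 0≤1ℚ
0≤𝟙 false = ℚ.≤-refl

𝟙≤1 : ∀ b → 𝟙 b ≤ 1ℚ
𝟙≤1 true  = ℚ.≤-refl
𝟙≤1 false = 0≤1ℚ

∑-filter : ∀ {P : Pred A 0ℓ} (P? : Decidable P) xs f →
  ∑ (filter P? xs) f ≡ ∑ xs (λ x → f x * 𝟙 (does (P? x)))
∑-filter P? []       f = refl
∑-filter P? (x ∷ xs) f with does (P? x)
... | true  = cong₂ _+_ (sym (ℚ.*-identityʳ (f x))) (∑-filter P? xs f)
... | false = trans (∑-filter P? xs f) (trans (sym (ℚ.+-identityˡ _)) (cong (_+ _) (sym (ℚ.*-zeroʳ (f x)))))

ι-length : (xs : List A) → ι (length xs) ≡ ∑ xs (λ _ → 1ℚ)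
ι-length []       = ι-0
ι-length (x ∷ xs) = trans (ι-+ 1 (length xs)) (cong₂ _+_ ι-1 (ι-length xs))

weighted : (xs : List A) (w : A → ℚ) (Supp : A → Set) → (∀ x → 0ℚ ≤ w x) →
           (∀ x → Supp x ⊎ w x ≡ 0ℚ) → ∑ xs w ≡ 1ℚ → Expectation A
weighted {A} xs w Supp 0≤w supp sum = record
  { 𝔼       = λ f → ∑ xs (λ x → w x * f x)
  ; Support = Supp
  ; mono    = λ f≤g → ∑-mono xs (λ x → term f≤g x (supp x))
  ; add     = λ f g → trans (∑.cong-≗ xs λ x → ℚ.*-distribˡ-+ (w x) (f x) (g x)) (∑.add xs _ _)
  ; scale   = λ c f → trans (∑.cong-≗ xs λ x → swap (w x) c (f x)) (∑.scale xs c _)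
  ; total   = trans (∑.cong-≗ xs λ x → ℚ.*-identityʳ (w x)) sum
  ; fubini  = λ lin f → fubini lin f xs
  }
  where
  swap : ∀ a b c → a * (b * c) ≡ b * (a * c)
  swap = R.solve 3 (λ a b c → a R.:* (b R.:* c) R.:= b R.:* (a R.:* c)) refl
  term : ∀ {f g : A → ℚ} → (∀ x → Supp x → f x ≤ g x) → ∀ x → Supp x ⊎ w x ≡ 0ℚ → w x * f x ≤ w x * g x
  term f≤g x (inj₁ s) = ℚ.*-monoˡ-≤-nonNeg (w x) {{ℚ.nonNegative (0≤w x)}} (f≤g x s)
  term {f} {g} f≤g x (inj₂ w≡0) rewrite w≡0 = ℚ.≤-reflexive (trans (ℚ.*-zeroˡ (f x)) (sym (ℚ.*-zeroˡ (g x))))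
  fubini : ∀ {B} {L : (B → ℚ) → ℚ} → IsLinear L → ∀ (f : A → B → ℚ) xs →
           L (λ b → ∑ xs (λ a → w a * f a b)) ≡ ∑ xs (λ a → w a * L (f a))
  fubini lin f []       = IsLinear.zeros lin
  fubini lin f (x ∷ xs) = trans (IsLinear.add lin _ _)
    (cong₂ _+_ (IsLinear.scale lin (w x) (f x)) (fubini lin f xs))

dirac : A → Expectation A
dirac x = record
  { 𝔼       = λ f → f x
  ; Support = λ _ → ⊤
  ; mono    = λ f≤g → f≤g x tt
  ; add     = λ _ _ → refl
  ; scale   = λ _ _ → refl
  ; total   = refl
  ; fubini  = λ _ _ → refl
  }

power : Expectation A → ∀ m → Expectation (Vec A m)
power X zero    = dirac []
power X (suc m) = record
  { 𝔼       = λ f → X.𝔼 λ x → Xᵐ.𝔼 λ v → f (x ∷ v)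
  ; Support = λ v → X.Support (Vec.head v) × Xᵐ.Support (Vec.tail v)
  ; mono    = λ f≤g → X.mono λ x s → Xᵐ.mono λ v s′ → f≤g (x ∷ v) (s , s′)
  ; add     = λ f g → trans (X.ext λ x → Xᵐ.add _ _) (X.add _ _)
  ; scale   = λ c f → trans (X.ext λ x → Xᵐ.scale c _) (X.scale c _)
  ; total   = trans (X.ext λ x → Xᵐ.total) X.total
  ; fubini  = λ lin f → trans (X.fubini lin _) (X.ext λ x → Xᵐ.fubini lin _)
  }
  where
  module X  = Expectation X
  module Xᵐ = Expectation (power X m)

-- This is what makes the blocks of nodes independent: averaging over a concatenation is averaging
-- over its pieces in turn.
power-++ : (X : Expectation A) → ∀ m n f → let open Expectation in
  𝔼 (power X (m ℕ.+ n)) f ≡ 𝔼 (power X m) λ u → 𝔼 (power X n) λ v → f (u Vec.++ v)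
power-++ X zero    n f = refl
power-++ X (suc m) n f = Expectation.ext X λ x → power-++ X m n _

vsum : ∀ {m} → (A → ℚ) → Vec A m → ℚ
vsum f []      = 0ℚ
vsum f (x ∷ v) = f x + vsum f v

vsum-fubini : ∀ {m} {L : (B → ℚ) → ℚ} → IsLinear L → (f : A → B → ℚ) (v : Vec A m) →
  L (λ b → vsum (λ a → f a b) v) ≡ vsum (λ a → L (f a)) v
vsum-fubini lin f []      = IsLinear.zeros lin
vsum-fubini {L = L} lin f (x ∷ v) = trans (IsLinear.add lin (f x) (λ b → vsum (λ a → f a b) v))
  (cong (L (f x) +_) (vsum-fubini lin f v))

vsum-zero : ∀ {m} {f : A → ℚ} (v : Vec A m) → (∀ i → f (Vec.lookup v i) ≡ 0ℚ) → vsum f v ≡ 0ℚ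
vsum-zero []      eq = refl
vsum-zero (x ∷ v) eq = cong₂ _+_ (eq Fin.zero) (vsum-zero v (λ i → eq (Fin.suc i)))

-- First and second moments of sums over independent blocks

module Moments (X : Expectation A) (m : ℕ) where
  open Expectation X
  private
    module Xᵐ where
      open module Y {m} = Expectation (power X m) public
    module Xₘ = Expectation (power X m)

  𝔼ᵐ : (Vec A m → ℚ) → ℚ
  𝔼ᵐ = Xₘ.𝔼

  private
    first : ∀ n g → Xᵐ.𝔼 {n} (vsum g) ≡ ι n * 𝔼 g
    first zero    g = sym (trans (cong (_* 𝔼 g) ι-0) (ℚ.*-zeroˡ (𝔼 g)))
    first (suc n) g = begin
      𝔼 (λ x → Xᵐ.𝔼 {n} (λ v → g x + vsum g v))  ≡⟨ ext (λ x → trans (Xᵐ.add {n} _ _) (cong₂ _+_ (Xᵐ.constant {n} (g x)) (first n g))) ⟩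
      𝔼 (λ x → g x + ι n * 𝔼 g)                  ≡⟨ trans (add g _) (cong (𝔼 g +_) (constant _)) ⟩
      𝔼 g + ι n * 𝔼 g                            ≡⟨ R.solve 2 (λ e n → e R.:+ n R.:* e R.:= (R.con 1ℚ R.:+ n) R.:* e) refl (𝔼 g) (ι n) ⟩
      (1ℚ + ι n) * 𝔼 g                           ≡⟨ cong (_* 𝔼 g) (trans (ι-+ 1 n) (cong (_+ ι n) ι-1)) ⟨
      ι (suc n) * 𝔼 g                            ∎
      where open ≡-Reasoning

    -- Split off the head; independence turns the cross term into twice a product of means. The
    -- exact number of off-diagonal pairs is n(n - 1); rounding it up to n² costs one `e * e` per
    -- step and keeps the bound polynomial in `ι n`.
    second : ∀ n g → Xᵐ.𝔼 {n} (λ v → vsum g v * vsum g v) ≤ ι n * 𝔼 (λ x → g x * g x) + ι n * ι n * (𝔼 g * 𝔼 g)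
    second zero    g rewrite ι-0 = ℚ.≤-reflexive
      (R.solve 2 (λ a b → R.con 0ℚ R.:= R.con 0ℚ R.:* a R.:+ R.con 0ℚ R.:* R.con 0ℚ R.:* b) refl (𝔼 (λ x → g x * g x)) (𝔼 g * 𝔼 g))
    second (suc n) g = begin
      𝔼 (λ x → Xᵐ.𝔼 {n} (λ v → (g x + vsum g v) * (g x + vsum g v)))
        ≡⟨ ext (λ x → trans (Xᵐ.ext {n} (λ v → square (g x) (vsum g v)))
             (trans (Xᵐ.add {n} (λ v → g x * g x + two * g x * vsum g v) (λ v → vsum g v * vsum g v))
               (cong (_+ s) (trans (Xᵐ.add {n} (λ _ → g x * g x) (λ v → two * g x * vsum g v))
                 (cong₂ _+_ (Xᵐ.constant {n} (g x * g x))
                   (trans (Xᵐ.scale {n} (two * g x) (vsum g)) (cong (two * g x *_) (first n g)))))))) ⟩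
      𝔼 (λ x → g x * g x + two * g x * (ι n * e) + s)
        ≡⟨ trans (add (λ x → g x * g x + two * g x * (ι n * e)) (λ _ → s)) (cong₂ _+_
             (trans (add (λ x → g x * g x) (λ x → two * g x * (ι n * e))) (cong (e₂ +_)
               (trans (ext (λ x → swap two (g x) (ι n * e))) (scale (ι n * e * two) g))))
             (constant s)) ⟩
      e₂ + ι n * e * two * e + s
        ≤⟨ ℚ.+-monoʳ-≤ (e₂ + ι n * e * two * e) (second n g) ⟩
      e₂ + ι n * e * two * e + (ι n * e₂ + ι n * ι n * (e * e))
        ≤⟨ ≤-by (square≥0 e) (collect e₂ e (ι n)) ⟩
      (1ℚ + ι n) * e₂ + (1ℚ + ι n) * (1ℚ + ι n) * (e * e)
        ≡⟨ cong (λ k → k * e₂ + k * k * (e * e)) (trans (ι-+ 1 n) (cong (_+ ι n) ι-1)) ⟨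
      ι (suc n) * e₂ + ι (suc n) * ι (suc n) * (e * e) ∎
      where
      open ℚ.≤-Reasoning
      two e e₂ s : ℚ
      two = 1ℚ + 1ℚ
      e   = 𝔼 g
      e₂  = 𝔼 (λ x → g x * g x)
      s   = Xᵐ.𝔼 {n} (λ v → vsum g v * vsum g v)
      swap : ∀ a b c → a * b * c ≡ c * a * b
      swap = R.solve 3 (λ a b c → a R.:* b R.:* c R.:= c R.:* a R.:* b) refl
      square : ∀ a b → (a + b) * (a + b) ≡ a * a + two * a * b + b * b
      square = R.solve 2 (λ a b → (a R.:+ b) R.:* (a R.:+ b) R.:= a R.:* a R.:+ R.con two R.:* a R.:* b R.:+ b R.:* b) refl
      collect : ∀ s e n → e * e ≡ ((1ℚ + n) * s + (1ℚ + n) * (1ℚ + n) * (e * e))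
                - (s + n * e * two * e + (n * s + n * n * (e * e)))
      collect = R.solve 3 (λ s e n → let o = R.con 1ℚ in e R.:* e R.:=
        ((o R.:+ n) R.:* s R.:+ (o R.:+ n) R.:* (o R.:+ n) R.:* (e R.:* e))
        R.:- (s R.:+ n R.:* e R.:* R.con two R.:* e R.:+ (n R.:* s R.:+ n R.:* n R.:* (e R.:* e)))) refl

  μ : ℚ
  μ = ι m

  0≤μ : 0ℚ ≤ μ
  0≤μ = 0≤ι m

  first-moment₁ : ∀ g → 𝔼ᵐ (vsum g) ≡ μ * 𝔼 g
  first-moment₁ = first m

  second-moment₁ : ∀ g → 𝔼ᵐ (λ v → vsum g v * vsum g v) ≤ μ * 𝔼 (λ x → g x * g x) + μ * μ * (𝔼 g * 𝔼 g)
  second-moment₁ = second m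

  vsum₂ : (A → A → ℚ) → Vec A m → Vec A m → ℚ
  vsum₂ k u v = vsum (λ b → vsum (λ a → k a b) u) v

  vsum₃ : (A → A → A → ℚ) → Vec A m → Vec A m → Vec A m → ℚ
  vsum₃ k u v w = vsum (λ c → vsum₂ (λ a b → k a b c) u v) w

  first-moment₂ : ∀ k → 𝔼ᵐ (λ u → 𝔼ᵐ (vsum₂ k u)) ≡ μ * μ * 𝔼 (λ b → 𝔼 (λ a → k a b))
  first-moment₂ k = begin
    𝔼ᵐ (λ u → 𝔼ᵐ (vsum₂ k u))                         ≡⟨ Xₘ.ext (λ u → first-moment₁ _) ⟩
    𝔼ᵐ (λ u → μ * 𝔼 (λ b → vsum (λ a → k a b) u))     ≡⟨ Xₘ.scale μ _ ⟩
    μ * 𝔼ᵐ (λ u → 𝔼 (λ b → vsum (λ a → k a b) u))     ≡⟨ cong (μ *_) (fubini Xₘ.linear _) ⟩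
    μ * 𝔼 (λ b → 𝔼ᵐ (vsum (λ a → k a b)))             ≡⟨ cong (μ *_) (trans (ext λ b → first-moment₁ _) (scale μ _)) ⟩
    μ * (μ * 𝔼 (λ b → 𝔼 (λ a → k a b)))               ≡⟨ ℚ.*-assoc μ μ _ ⟨
    μ * μ * 𝔼 (λ b → 𝔼 (λ a → k a b))                 ∎
    where open ≡-Reasoning

  first-moment₃ : ∀ k → 𝔼ᵐ (λ u → 𝔼ᵐ (λ v → 𝔼ᵐ (vsum₃ k u v))) ≡ μ * μ * μ * 𝔼 (λ c → 𝔼 (λ b → 𝔼 (λ a → k a b c)))
  first-moment₃ k = begin
    𝔼ᵐ (λ u → 𝔼ᵐ (λ v → 𝔼ᵐ (vsum₃ k u v)))
      ≡⟨ Xₘ.ext (λ u → trans (Xₘ.ext (λ v → first-moment₁ _)) (trans (Xₘ.scale μ _) (cong (μ *_) (fubini Xₘ.linear _)))) ⟩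
    𝔼ᵐ (λ u → μ * 𝔼 (λ c → 𝔼ᵐ (vsum₂ (λ a b → k a b c) u)))
      ≡⟨ trans (Xₘ.scale μ _) (cong (μ *_) (fubini Xₘ.linear _)) ⟩
    μ * 𝔼 (λ c → 𝔼ᵐ (λ u → 𝔼ᵐ (vsum₂ (λ a b → k a b c) u)))
      ≡⟨ cong (μ *_) (trans (ext λ c → first-moment₂ _) (scale (μ * μ) _)) ⟩
    μ * (μ * μ * 𝔼 (λ c → 𝔼 (λ b → 𝔼 (λ a → k a b c))))
      ≡⟨ trans (sym (ℚ.*-assoc μ (μ * μ) _)) (cong (_* 𝔼 (λ c → 𝔼 (λ b → 𝔼 (λ a → k a b c)))) (sym (ℚ.*-assoc μ μ μ))) ⟩
    μ * μ * μ * 𝔼 (λ c → 𝔼 (λ b → 𝔼 (λ a → k a b c))) ∎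
    where open ≡-Reasoning

  sq : ℚ → ℚ
  sq x = x * x

  -- The one-block bound applied twice. For each block, a factor μ means that the two copies of the
  -- sum use the same entry, and μ² that they use separate entries, in which case the kernel is
  -- averaged before squaring. This gives four terms for two blocks and eight for three.
  bound₂ : (A → A → ℚ) → ℚ
  bound₂ k = μ * (μ * 𝔼 (λ b → 𝔼 (λ a → sq (k a b))) + μ * μ * 𝔼 (λ b → sq (𝔼 (λ a → k a b))))
           + μ * μ * (μ * 𝔼 (λ a → sq (𝔼 (k a))) + μ * μ * sq (𝔼 (λ a → 𝔼 (k a))))

  second-moment₂ : ∀ k → 𝔼ᵐ (λ u → 𝔼ᵐ (λ v → sq (vsum₂ k u v))) ≤ bound₂ k
  second-moment₂ k = begin
    𝔼ᵐ (λ u → 𝔼ᵐ (λ v → sq (vsum₂ k u v)))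
      ≤⟨ Xₘ.mono (λ u _ → second-moment₁ _) ⟩
    𝔼ᵐ (λ u → μ * 𝔼 (λ b → sq (vsum (λ a → k a b) u)) + μ * μ * sq (𝔼 (λ b → vsum (λ a → k a b) u)))
      ≡⟨ trans (Xₘ.add _ _) (cong₂ _+_
           (trans (Xₘ.scale μ _) (cong (μ *_) (fubini Xₘ.linear _)))
           (trans (Xₘ.scale (μ * μ) _) (cong (μ * μ *_) (Xₘ.ext (λ u → cong sq (vsum-fubini linear k u)))))) ⟩
    μ * 𝔼 (λ b → 𝔼ᵐ (λ u → sq (vsum (λ a → k a b) u))) + μ * μ * 𝔼ᵐ (λ u → sq (vsum (λ a → 𝔼 (k a)) u))
      ≤⟨ ℚ.+-mono-≤
           (ℚ.*-monoˡ-≤-nonNeg μ {{ℚ.nonNegative 0≤μ}} (ℚ.≤-trans (mono (λ b _ → second-moment₁ _))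
              (ℚ.≤-reflexive (trans (add (λ b → μ * 𝔼 (λ a → sq (k a b))) (λ b → μ * μ * sq (𝔼 (λ a → k a b)))) (cong₂ _+_ (scale μ _) (scale (μ * μ) _))))))
           (ℚ.*-monoˡ-≤-nonNeg (μ * μ) {{ℚ.nonNegative (square≥0 μ)}} (second-moment₁ _)) ⟩
    bound₂ k ∎
    where open ℚ.≤-Reasoning

  -- The last block is treated first: its entry is either shared, leaving the kernel with `c` fixed,
  -- or separate, leaving the kernel averaged over `c`. `bound₂` handles the other two blocks.
  second-moment₃ : ∀ k → 𝔼ᵐ (λ u → 𝔼ᵐ (λ v → 𝔼ᵐ (λ w → sq (vsum₃ k u v w))))
    ≤ μ * 𝔼 (λ c → bound₂ (λ a b → k a b c)) + μ * μ * bound₂ (λ a b → 𝔼 (k a b))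
  second-moment₃ k = begin
    𝔼ᵐ (λ u → 𝔼ᵐ (λ v → 𝔼ᵐ (λ w → sq (vsum₃ k u v w))))
      ≤⟨ Xₘ.mono (λ u _ → Xₘ.mono (λ v _ → second-moment₁ _)) ⟩
    𝔼ᵐ (λ u → 𝔼ᵐ (λ v → μ * 𝔼 (λ c → sq (vsum₂ (λ a b → k a b c) u v)) + μ * μ * sq (𝔼 (λ c → vsum₂ (λ a b → k a b c) u v))))
      ≡⟨ trans (Xₘ.ext split) (trans (Xₘ.add (λ u → μ * 𝔼 (λ c → 𝔼ᵐ (λ v → slice u v c))) (λ u → μ * μ * 𝔼ᵐ (average u))) (cong₂ _+_
           (trans (Xₘ.scale μ (λ u → 𝔼 (λ c → 𝔼ᵐ (λ v → slice u v c)))) (cong (μ *_) (fubini Xₘ.linear _)))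
           (Xₘ.scale (μ * μ) (λ u → 𝔼ᵐ (average u))))) ⟩
    μ * 𝔼 (λ c → 𝔼ᵐ (λ u → 𝔼ᵐ (λ v → sq (vsum₂ (λ a b → k a b c) u v))))
      + μ * μ * 𝔼ᵐ (λ u → 𝔼ᵐ (λ v → sq (vsum₂ (λ a b → 𝔼 (k a b)) u v)))
      ≤⟨ ℚ.+-mono-≤
           (ℚ.*-monoˡ-≤-nonNeg μ {{ℚ.nonNegative 0≤μ}} (mono (λ c _ → second-moment₂ _)))
           (ℚ.*-monoˡ-≤-nonNeg (μ * μ) {{ℚ.nonNegative (square≥0 μ)}} (second-moment₂ _)) ⟩
    μ * 𝔼 (λ c → bound₂ (λ a b → k a b c)) + μ * μ * bound₂ (λ a b → 𝔼 (k a b)) ∎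
    where
    open ℚ.≤-Reasoning
    vsum-cong : ∀ {n} {f g : A → ℚ} → (∀ x → f x ≡ g x) → (v : Vec A n) → vsum f v ≡ vsum g v
    vsum-cong eq []      = refl
    vsum-cong eq (x ∷ v) = cong₂ _+_ (eq x) (vsum-cong eq v)
    slice : Vec A m → Vec A m → A → ℚ
    slice u v c = sq (vsum₂ (λ a b → k a b c) u v)
    average : Vec A m → Vec A m → ℚ
    average u v = sq (vsum₂ (λ a b → 𝔼 (k a b)) u v)
    slice-mean : ∀ u v → 𝔼 (λ c → vsum₂ (λ a b → k a b c) u v) ≡ vsum₂ (λ a b → 𝔼 (k a b)) u v
    slice-mean u v = trans (vsum-fubini linear _ v) (vsum-cong (λ b → vsum-fubini linear (λ a c → k a b c) u) v)
    split : ∀ u → 𝔼ᵐ (λ v → μ * 𝔼 (slice u v) + μ * μ * sq (𝔼 (λ c → vsum₂ (λ a b → k a b c) u v)))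
                ≡ μ * 𝔼 (λ c → 𝔼ᵐ (λ v → slice u v c)) + μ * μ * 𝔼ᵐ (average u)
    split u = trans (Xₘ.add (λ v → μ * 𝔼 (slice u v)) _) (cong₂ _+_
      (trans (Xₘ.scale μ (λ v → 𝔼 (slice u v))) (cong (μ *_) (fubini Xₘ.linear _)))
      (trans (Xₘ.scale (μ * μ) _) (cong (μ * μ *_) (Xₘ.ext (λ v → cong sq (slice-mean u v))))))

  module Symmetric (χ : A → A → A → ℚ) (p β : ℚ)
    (swap₁₂     : ∀ a b c → χ a b c ≡ χ b a c)
    (swap₂₃     : ∀ a b c → χ a b c ≡ χ a c b)
    (idempotent : ∀ a b c → sq (χ a b c) ≡ χ a b c)
    (pair≤p     : ∀ a b → Support a → 𝔼 (χ a b) ≤ p)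
    (point≡β    : ∀ a → Support a → 𝔼 (λ b → 𝔼 (χ a b)) ≡ β)
    where

    private
      rotate : ∀ a b c → χ a b c ≡ χ c a b
      rotate a b c = trans (swap₂₃ a b c) (swap₁₂ a c b)

      reverse : ∀ a b c → χ a b c ≡ χ c b a
      reverse a b c = trans (rotate a b c) (swap₂₃ c a b)

      0≤χ : ∀ a b c → 0ℚ ≤ χ a b c
      0≤χ a b c = subst (0ℚ ≤_) (idempotent a b c) (square≥0 (χ a b c))

      point₂ : ∀ b → Support b → 𝔼 (λ a → 𝔼 (χ a b)) ≡ β
      point₂ b s = trans (ext λ a → ext λ c → swap₁₂ a b c) (point≡β b s)

      point₃ : ∀ c → Support c → 𝔼 (λ b → 𝔼 (λ a → χ a b c)) ≡ β
      point₃ c s = trans (ext λ b → ext λ a → reverse a b c) (point≡β c s)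

      point₃′ : ∀ c → Support c → 𝔼 (λ a → 𝔼 (λ b → χ a b c)) ≡ β
      point₃′ c s = trans (ext λ a → ext λ b → rotate a b c) (point≡β c s)

      -- This is the contribution of two triangles on a common edge: one factor `𝔼 (χ a b)` is
      -- bounded by `p`, the other averages to β.
      pair-square : ∀ a → Support a → 𝔼 (λ b → sq (𝔼 (χ a b))) ≤ p * β
      pair-square a s = ℚ.≤-trans
        (mono λ b _ → ℚ.*-monoʳ-≤-nonNeg (𝔼 (χ a b)) {{ℚ.nonNegative (nonNegative λ c _ → 0≤χ a b c)}} (pair≤p a b s))
        (ℚ.≤-reflexive (trans (scale p (λ b → 𝔼 (χ a b))) (cong (p *_) (point≡β a s))))

      pair-square₃ : ∀ c → Support c → 𝔼 (λ b → sq (𝔼 (λ a → χ a b c))) ≤ p * β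
      pair-square₃ c s = ℚ.≤-trans (ℚ.≤-reflexive (ext λ b → cong sq (ext λ a → reverse a b c))) (pair-square c s)

      pair-square₃′ : ∀ c → Support c → 𝔼 (λ a → sq (𝔼 (λ b → χ a b c))) ≤ p * β
      pair-square₃′ c s = ℚ.≤-trans (ℚ.≤-reflexive (ext λ a → cong sq (ext λ b → rotate a b c))) (pair-square c s)

      averaged : ∀ {f r} → (∀ x → Support x → f x ≤ r) → 𝔼 f ≤ r
      averaged {f} {r} f≤r = subst (𝔼 f ≤_) (constant r) (mono f≤r)

      averaged-≡ : ∀ {f r} → (∀ x → Support x → f x ≡ r) → 𝔼 f ≡ r
      averaged-≡ {f} {r} f≡r = trans (cong-on f≡r) (constant r)

      scaled : ∀ {c x y} → 0ℚ ≤ c → x ≤ y → c * x ≤ c * y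
      scaled {c} 0≤c = ℚ.*-monoˡ-≤-nonNeg c {{ℚ.nonNegative 0≤c}}

      0≤μ² : 0ℚ ≤ μ * μ
      0≤μ² = square≥0 μ

      bound-slice : ∀ c → Support c → bound₂ (λ a b → χ a b c)
        ≤ μ * (μ * β + μ * μ * (p * β)) + μ * μ * (μ * (p * β) + μ * μ * sq β)
      bound-slice c s = ℚ.+-mono-≤
        (scaled 0≤μ (ℚ.+-mono-≤
          (scaled 0≤μ (ℚ.≤-reflexive (trans (ext λ b → ext λ a → idempotent a b c) (point₃ c s))))
          (scaled 0≤μ² (pair-square₃ c s))))
        (scaled 0≤μ² (ℚ.+-mono-≤
          (scaled 0≤μ (pair-square₃′ c s))
          (scaled 0≤μ² (ℚ.≤-reflexive (cong sq (point₃′ c s))))))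

      bound-average : bound₂ (λ a b → 𝔼 (χ a b))
        ≤ μ * (μ * (p * β) + μ * μ * sq β) + μ * μ * (μ * sq β + μ * μ * sq β)
      bound-average = ℚ.+-mono-≤
        (scaled 0≤μ (ℚ.+-mono-≤
          (scaled 0≤μ (ℚ.≤-trans (ℚ.≤-reflexive (sym (fubini linear _))) (averaged pair-square)))
          (scaled 0≤μ² (averaged λ b s → ℚ.≤-reflexive (cong sq (point₂ b s))))))
        (scaled 0≤μ² (ℚ.+-mono-≤
          (scaled 0≤μ (averaged λ a s → ℚ.≤-reflexive (cong sq (point≡β a s))))
          (scaled 0≤μ² (ℚ.≤-reflexive (cong sq (averaged-≡ point≡β))))))

    T : Vec A m → Vec A m → Vec A m → ℚ
    T = vsum₃ χ

    𝔼³ : (Vec A m → Vec A m → Vec A m → ℚ) → ℚ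
    𝔼³ f = 𝔼ᵐ λ u → 𝔼ᵐ λ v → 𝔼ᵐ (f u v)

    mean : 𝔼³ T ≡ μ * μ * μ * β
    mean = trans (first-moment₃ χ) (cong (μ * μ * μ *_) (averaged-≡ point₃))

    -- Of the eight terms, sharing all three nodes gives μ³β, sharing two gives three terms μ⁴pβ,
    -- sharing one gives three terms μ⁵β², and sharing none gives μ⁶β², which cancels against M².
    -- The terms μ⁵β² are no covariances: they survive only because off-diagonal pairs were counted
    -- as μ² per block.
    variance : 𝔼³ (λ u v w → sq (T u v w - μ * μ * μ * β))
      ≤ μ * μ * μ * β + (1ℚ + 1ℚ + 1ℚ) * (μ * μ * μ * μ * p * β) + (1ℚ + 1ℚ + 1ℚ) * (μ * μ * μ * μ * μ * β * β)
    variance = begin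
      𝔼³ (λ u v w → sq (T u v w - M))
        ≡⟨ Xₘ.ext (λ u → trans (Xₘ.ext (λ v → expand (T u v))) (expand′ (λ v → 𝔼ᵐ (λ w → sq (T u v w))) (λ v → 𝔼ᵐ (T u v)))) ⟩
      𝔼ᵐ (λ u → 𝔼ᵐ (λ v → 𝔼ᵐ (λ w → sq (T u v w))) + - (1ℚ + 1ℚ) * M * 𝔼ᵐ (λ v → 𝔼ᵐ (T u v)) + M * M)
        ≡⟨ expand′ (λ u → 𝔼ᵐ (λ v → 𝔼ᵐ (λ w → sq (T u v w)))) (λ u → 𝔼ᵐ (λ v → 𝔼ᵐ (T u v))) ⟩
      𝔼³ (λ u v w → sq (T u v w)) + - (1ℚ + 1ℚ) * M * 𝔼³ T + M * M
        ≡⟨ cong (λ e → 𝔼³ (λ u v w → sq (T u v w)) + - (1ℚ + 1ℚ) * M * e + M * M) mean ⟩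
      𝔼³ (λ u v w → sq (T u v w)) + - (1ℚ + 1ℚ) * M * M + M * M
        ≤⟨ ℚ.+-monoˡ-≤ (M * M) (ℚ.+-monoˡ-≤ (- (1ℚ + 1ℚ) * M * M) (ℚ.≤-trans (second-moment₃ χ)
             (ℚ.+-mono-≤ (scaled 0≤μ (averaged bound-slice)) (scaled 0≤μ² bound-average)))) ⟩
      μ * (μ * (μ * β + μ * μ * (p * β)) + μ * μ * (μ * (p * β) + μ * μ * sq β))
        + μ * μ * (μ * (μ * (p * β) + μ * μ * sq β) + μ * μ * (μ * sq β + μ * μ * sq β))
        + - (1ℚ + 1ℚ) * M * M + M * M
        ≡⟨ collect μ p β ⟩
      μ * μ * μ * β + (1ℚ + 1ℚ + 1ℚ) * (μ * μ * μ * μ * p * β) + (1ℚ + 1ℚ + 1ℚ) * (μ * μ * μ * μ * μ * β * β) ∎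
      where
      open ℚ.≤-Reasoning
      M : ℚ
      M = μ * μ * μ * β
      square : ∀ t m → (t - m) * (t - m) ≡ t * t + - (1ℚ + 1ℚ) * m * t + m * m
      square = R.solve 2 (λ t m → (t R.:- m) R.:* (t R.:- m) R.:= t R.:* t R.:+ R.con (- (1ℚ + 1ℚ)) R.:* m R.:* t R.:+ m R.:* m) refl
      expand′ : ∀ f g → 𝔼ᵐ (λ u → f u + - (1ℚ + 1ℚ) * M * g u + M * M) ≡ 𝔼ᵐ f + - (1ℚ + 1ℚ) * M * 𝔼ᵐ g + M * M
      expand′ f g = trans (Xₘ.add (λ u → f u + - (1ℚ + 1ℚ) * M * g u) (λ _ → M * M)) (cong₂ _+_
        (trans (Xₘ.add f (λ u → - (1ℚ + 1ℚ) * M * g u)) (cong (𝔼ᵐ f +_) (Xₘ.scale (- (1ℚ + 1ℚ) * M) g)))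
        (Xₘ.constant (M * M)))
      expand : ∀ t → 𝔼ᵐ (λ w → sq (t w - M)) ≡ 𝔼ᵐ (λ w → sq (t w)) + - (1ℚ + 1ℚ) * M * 𝔼ᵐ t + M * M
      expand t = trans (Xₘ.ext λ w → square (t w) M) (expand′ (λ w → sq (t w)) t)
      collect : ∀ μ p β →
        μ * (μ * (μ * β + μ * μ * (p * β)) + μ * μ * (μ * (p * β) + μ * μ * (β * β)))
        + μ * μ * (μ * (μ * (p * β) + μ * μ * (β * β)) + μ * μ * (μ * (β * β) + μ * μ * (β * β)))
        + - (1ℚ + 1ℚ) * (μ * μ * μ * β) * (μ * μ * μ * β) + (μ * μ * μ * β) * (μ * μ * μ * β)
        ≡ μ * μ * μ * β + (1ℚ + 1ℚ + 1ℚ) * (μ * μ * μ * μ * p * β) + (1ℚ + 1ℚ + 1ℚ) * (μ * μ * μ * μ * μ * β * β)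
      collect = R.solve 3 (λ m p b → let infixl 6 _⊕_ ; infixl 7 _⊗_ ; _⊕_ = R._:+_ ; _⊗_ = R._:*_ in
        m ⊗ (m ⊗ (m ⊗ b ⊕ m ⊗ m ⊗ (p ⊗ b)) ⊕ m ⊗ m ⊗ (m ⊗ (p ⊗ b) ⊕ m ⊗ m ⊗ (b ⊗ b)))
        ⊕ m ⊗ m ⊗ (m ⊗ (m ⊗ (p ⊗ b) ⊕ m ⊗ m ⊗ (b ⊗ b)) ⊕ m ⊗ m ⊗ (m ⊗ (b ⊗ b) ⊕ m ⊗ m ⊗ (b ⊗ b)))
        ⊕ R.con (- (1ℚ + 1ℚ)) ⊗ (m ⊗ m ⊗ m ⊗ b) ⊗ (m ⊗ m ⊗ m ⊗ b) ⊕ (m ⊗ m ⊗ m ⊗ b) ⊗ (m ⊗ m ⊗ m ⊗ b)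
        R.:= m ⊗ m ⊗ m ⊗ b ⊕ R.con (1ℚ + 1ℚ + 1ℚ) ⊗ (m ⊗ m ⊗ m ⊗ m ⊗ p ⊗ b) ⊕ R.con (1ℚ + 1ℚ + 1ℚ) ⊗ (m ⊗ m ⊗ m ⊗ m ⊗ m ⊗ b ⊗ b)) refl

-- Uniform key rings

-- A Boolean recursion on characteristic vectors, so that counting and the algebra of indicators
-- proceed by cases; `χ-vanish` makes the passage back to `Nonempty`.
disjoint : ∀ {P} → Subset P → Subset P → Bool
disjoint []            []            = true
disjoint (inside  ∷ S) (inside  ∷ T) = false
disjoint (inside  ∷ S) (outside ∷ T) = disjoint S T
disjoint (outside ∷ S) (_       ∷ T) = disjoint S T

disjoint-comm : ∀ {P} (S T : Subset P) → disjoint S T ≡ disjoint T S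
disjoint-comm []            []            = refl
disjoint-comm (inside  ∷ S) (inside  ∷ T) = refl
disjoint-comm (inside  ∷ S) (outside ∷ T) = disjoint-comm S T
disjoint-comm (outside ∷ S) (inside  ∷ T) = disjoint-comm S T
disjoint-comm (outside ∷ S) (outside ∷ T) = disjoint-comm S T

disjoint-⊥ : ∀ {P} (T : Subset P) → disjoint Subset.⊥ T ≡ true
disjoint-⊥ []      = refl
disjoint-⊥ (_ ∷ T) = disjoint-⊥ T

disjoint-∪ : ∀ {P} (S S′ T : Subset P) → disjoint (S ∪ S′) T ≡ disjoint S T ∧ disjoint S′ T
disjoint-∪ []            []             []            = refl
disjoint-∪ (inside  ∷ S) (_       ∷ S′) (inside  ∷ T) = refl
disjoint-∪ (inside  ∷ S) (inside  ∷ S′) (outside ∷ T) = disjoint-∪ S S′ T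
disjoint-∪ (inside  ∷ S) (outside ∷ S′) (outside ∷ T) = disjoint-∪ S S′ T
disjoint-∪ (outside ∷ S) (outside ∷ S′) (_       ∷ T) = disjoint-∪ S S′ T
disjoint-∪ (outside ∷ S) (inside  ∷ S′) (outside ∷ T) = disjoint-∪ S S′ T
disjoint-∪ (outside ∷ S) (inside  ∷ S′) (inside  ∷ T) = ∧-false (disjoint S T)
  where
  ∧-false : ∀ b → false ≡ b ∧ false
  ∧-false true  = refl
  ∧-false false = refl

∣∪∣-disjoint : ∀ {P} (S T : Subset P) → disjoint S T ≡ true → ∣ S ∪ T ∣ ≡ ∣ S ∣ ℕ.+ ∣ T ∣
∣∪∣-disjoint []            []            _  = refl
∣∪∣-disjoint (inside  ∷ S) (outside ∷ T) eq = cong suc (∣∪∣-disjoint S T eq)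
∣∪∣-disjoint (outside ∷ S) (inside  ∷ T) eq = trans (cong suc (∣∪∣-disjoint S T eq)) (sym (ℕ.+-suc ∣ S ∣ ∣ T ∣))
∣∪∣-disjoint (outside ∷ S) (outside ∷ T) eq = ∣∪∣-disjoint S T eq

¬disjoint⇒Nonempty : ∀ {P} (S T : Subset P) → disjoint S T ≡ false → Nonempty (S ∩ T)
¬disjoint⇒Nonempty []            []            ()
¬disjoint⇒Nonempty (inside  ∷ S) (inside  ∷ T) _  = Fin.zero , here
¬disjoint⇒Nonempty (inside  ∷ S) (outside ∷ T) eq = let (i , i∈) = ¬disjoint⇒Nonempty S T eq in Fin.suc i , there i∈
¬disjoint⇒Nonempty (outside ∷ S) (_       ∷ T) eq = let (i , i∈) = ¬disjoint⇒Nonempty S T eq in Fin.suc i , there i∈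

-- The witness is the singleton of the first shared key. A third ring containing that key closes the
-- triangle, which is how `py≤β` uses it.
common-key : ∀ {P} (S T : Subset P) → disjoint S T ≡ false →
  ∃[ U ] ∣ U ∣ ≡ 1 × (∀ V → disjoint U V ≡ false → disjoint S V ≡ false × disjoint T V ≡ false)
common-key [] [] ()
common-key {suc P} (inside ∷ S) (inside ∷ T) _ = inside ∷ Subset.⊥ , cong suc (∣⊥∣≡0 P) , λ where
  (inside  ∷ V) _  → refl , refl
  (outside ∷ V) eq → case trans (sym (disjoint-⊥ V)) eq of λ ()
common-key (inside ∷ S) (outside ∷ T) eq with U , ∣U∣≡1 , h ← common-key S T eq = outside ∷ U , ∣U∣≡1 , λ where
  (inside  ∷ V) eq → refl , proj₂ (h V eq)
  (outside ∷ V) eq → h V eq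
common-key (outside ∷ S) (inside ∷ T) eq with U , ∣U∣≡1 , h ← common-key S T eq = outside ∷ U , ∣U∣≡1 , λ where
  (inside  ∷ V) eq → proj₁ (h V eq) , refl
  (outside ∷ V) eq → h V eq
common-key (outside ∷ S) (outside ∷ T) eq with U , ∣U∣≡1 , h ← common-key S T eq = outside ∷ U , ∣U∣≡1 , λ where
  (_ ∷ V) eq → h V eq

D : ∀ {P} → Subset P → Subset P → ℚ
D S T = 𝟙 (disjoint S T)

D-comm : ∀ {P} (S T : Subset P) → D S T ≡ D T S
D-comm S T = cong 𝟙 (disjoint-comm S T)

𝟙-∧ : ∀ x y → 𝟙 (x ∧ y) ≡ 𝟙 x * 𝟙 y
𝟙-∧ true  y = sym (ℚ.*-identityˡ (𝟙 y))
𝟙-∧ false y = sym (ℚ.*-zeroˡ (𝟙 y))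

D-∪ : ∀ {P} (S S′ T : Subset P) → D (S ∪ S′) T ≡ D S T * D S′ T
D-∪ S S′ T = trans (cong 𝟙 (disjoint-∪ S S′ T)) (𝟙-∧ (disjoint S T) (disjoint S′ T))

-- The factor `D S T` restricts to disjoint sets, where sizes add; otherwise both sides are 0.
D-∪-size : ∀ {P} (g : ℕ → ℚ) (S T : Subset P) → D S T * g ∣ S ∪ T ∣ ≡ D S T * g (∣ S ∣ ℕ.+ ∣ T ∣)
D-∪-size g S T with disjoint S T in eq
... | true  = cong (λ s → 1ℚ * g s) (∣∪∣-disjoint S T eq)
... | false = trans (ℚ.*-zeroˡ (g ∣ S ∪ T ∣)) (sym (ℚ.*-zeroˡ (g (∣ S ∣ ℕ.+ ∣ T ∣))))

hasSize : ∀ {P} → ℕ → Subset P → ℚ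
hasSize K S = 𝟙 (does (∣ S ∣ ℕ.≟ K))

∑-subsets-suc : ∀ P (f : Subset (suc P) → ℚ) →
  ∑ (subsets (suc P)) f ≡ ∑ (subsets P) (λ T → f (inside ∷ T)) + ∑ (subsets P) (λ T → f (outside ∷ T))
∑-subsets-suc P f = trans (∑-cartesianProductWith _∷_ (inside ∷ outside ∷ []) (subsets P) f)
  (cong (∑ (subsets P) (λ T → f (inside ∷ T)) +_) (ℚ.+-identityʳ (∑ (subsets P) (λ T → f (outside ∷ T)))))

∑-vanish : ∀ {A : Set} (xs : List A) f → (∀ x → f x ≡ 0ℚ) → ∑ xs f ≡ 0ℚ
∑-vanish xs f eq = trans (∑.cong-≗ xs eq) (∑.zeros xs)

-- A key of `S` is forbidden to `T` and changes nothing; any other key may be taken or left, which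
-- is Pascal's rule on the P - |S| free keys.
count-disjoint : ∀ {P} K (S : Subset P) → ∑ (subsets P) (λ T → hasSize K T * D S T) ≡ ι ((P ∸ ∣ S ∣) C K)
count-disjoint zero    []            = sym ι-1
count-disjoint (suc K) []            = sym ι-0
count-disjoint {suc P} K (inside ∷ S) = begin
  ∑ (subsets (suc P)) (λ T → hasSize K T * D (inside ∷ S) T)
    ≡⟨ ∑-subsets-suc P (λ T → hasSize K T * D (inside ∷ S) T) ⟩
  ∑ (subsets P) (λ T → hasSize K (inside ∷ T) * 0ℚ) + ∑ (subsets P) (λ T → hasSize K T * D S T)
    ≡⟨ cong₂ _+_ (∑-vanish (subsets P) (λ T → hasSize K (inside ∷ T) * 0ℚ) (λ T → ℚ.*-zeroʳ (hasSize K (inside ∷ T)))) (count-disjoint K S) ⟩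
  0ℚ + ι ((P ∸ ∣ S ∣) C K)
    ≡⟨ ℚ.+-identityˡ _ ⟩
  ι ((P ∸ ∣ S ∣) C K) ∎
  where open ≡-Reasoning
count-disjoint {suc P} zero (outside ∷ S) = begin
  ∑ (subsets (suc P)) (λ T → hasSize 0 T * D (outside ∷ S) T)
    ≡⟨ ∑-subsets-suc P (λ T → hasSize 0 T * D (outside ∷ S) T) ⟩
  ∑ (subsets P) (λ T → 0ℚ * D S T) + ∑ (subsets P) (λ T → hasSize 0 T * D S T)
    ≡⟨ cong₂ _+_ (∑-vanish (subsets P) (λ T → 0ℚ * D S T) (λ T → ℚ.*-zeroˡ (D S T))) (count-disjoint 0 S) ⟩
  0ℚ + ι 1
    ≡⟨ ℚ.+-identityˡ _ ⟩
  ι 1 ∎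
  where open ≡-Reasoning
count-disjoint {suc P} (suc K) (outside ∷ S) = begin
  ∑ (subsets (suc P)) (λ T → hasSize (suc K) T * D (outside ∷ S) T)
    ≡⟨ ∑-subsets-suc P (λ T → hasSize (suc K) T * D (outside ∷ S) T) ⟩
  ∑ (subsets P) (λ T → hasSize K T * D S T) + ∑ (subsets P) (λ T → hasSize (suc K) T * D S T)
    ≡⟨ cong₂ _+_ (count-disjoint K S) (count-disjoint (suc K) S) ⟩
  ι ((P ∸ ∣ S ∣) C K) + ι ((P ∸ ∣ S ∣) C suc K)
    ≡⟨ ι-+ _ _ ⟨
  ι ((P ∸ ∣ S ∣) C K ℕ.+ (P ∸ ∣ S ∣) C suc K)
    ≡⟨ cong ι (nCk+nC[k+1]≡[n+1]C[k+1] (P ∸ ∣ S ∣) K) ⟩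
  ι (suc (P ∸ ∣ S ∣) C suc K)
    ≡⟨ cong (λ n → ι (n C suc K)) (ℕ.+-∸-assoc 1 (∣p∣≤n S)) ⟨
  ι ((suc P ∸ ∣ S ∣) C suc K) ∎
  where open ≡-Reasoning

χ : ∀ {P} → Subset P → Subset P → Subset P → ℚ
χ a b c = (1ℚ - D a b) * (1ℚ - D b c) * (1ℚ - D a c)

χ-swap₁₂ : ∀ {P} (a b c : Subset P) → χ a b c ≡ χ b a c
χ-swap₁₂ a b c rewrite D-comm b a = R.solve 3 (λ x y z → x R.:* y R.:* z R.:= x R.:* z R.:* y) refl (1ℚ - D a b) (1ℚ - D b c) (1ℚ - D a c)

χ-swap₂₃ : ∀ {P} (a b c : Subset P) → χ a b c ≡ χ a c b
χ-swap₂₃ a b c rewrite D-comm c b = R.solve 3 (λ x y z → x R.:* y R.:* z R.:= z R.:* y R.:* x) refl (1ℚ - D a b) (1ℚ - D b c) (1ℚ - D a c)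

χ-idempotent : ∀ {P} (a b c : Subset P) → χ a b c * χ a b c ≡ χ a b c
χ-idempotent a b c = lemma (disjoint a b) (disjoint b c) (disjoint a c)
  where
  lemma : ∀ x y z → let t = (1ℚ - 𝟙 x) * (1ℚ - 𝟙 y) * (1ℚ - 𝟙 z) in t * t ≡ t
  lemma true  true  true  = refl
  lemma true  true  false = refl
  lemma true  false true  = refl
  lemma true  false false = refl
  lemma false true  true  = refl
  lemma false true  false = refl
  lemma false false true  = refl
  lemma false false false = refl

χ≤1-D : ∀ {P} (a b c : Subset P) → χ a b c ≤ 1ℚ - D a c
χ≤1-D a b c = lemma (disjoint a b) (disjoint b c) (disjoint a c)
  where
  lemma : ∀ x y z → (1ℚ - 𝟙 x) * (1ℚ - 𝟙 y) * (1ℚ - 𝟙 z) ≤ 1ℚ - 𝟙 z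
  lemma true  true  true  = ℚ.≤-refl
  lemma true  true  false = 0≤1ℚ
  lemma true  false true  = ℚ.≤-refl
  lemma true  false false = 0≤1ℚ
  lemma false true  true  = ℚ.≤-refl
  lemma false true  false = 0≤1ℚ
  lemma false false true  = ℚ.≤-refl
  lemma false false false = ℚ.≤-refl

χ-vanish : ∀ {P} (a b c : Subset P) →
  ¬ (Nonempty (a ∩ b) × Nonempty (b ∩ c) × Nonempty (a ∩ c)) → χ a b c ≡ 0ℚ
χ-vanish a b c ¬t with disjoint a b in ab | disjoint b c in bc | disjoint a c in ac
... | true  | true  | true  = refl
... | true  | true  | false = refl
... | true  | false | true  = refl
... | true  | false | false = refl
... | false | true  | true  = refl
... | false | true  | false = refl
... | false | false | true  = refl
... | false | false | false = ⊥-elim (¬t (¬disjoint⇒Nonempty a b ab , ¬disjoint⇒Nonempty b c bc , ¬disjoint⇒Nonempty a c ac))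

-- Disjointness and triangle probabilities of uniform key rings

module KeyRing (K P : ℕ) (1≤P : 1 ℕ.≤ P) (K≤P : K ℕ.≤ P) where

  private
    rings : List (Subset P)
    rings = filter (λ T → ∣ T ∣ ℕ.≟ K) (subsets P)

    N : ℕ
    N = length rings

    ιN : ι N ≡ ι (P C K)
    ιN = begin
      ι N                                             ≡⟨ ι-length rings ⟩
      ∑ rings (λ _ → 1ℚ)                              ≡⟨ ∑-filter (λ T → ∣ T ∣ ℕ.≟ K) (subsets P) (λ _ → 1ℚ) ⟩
      ∑ (subsets P) (λ T → 1ℚ * hasSize K T)          ≡⟨ ∑.cong-≗ (subsets P) (λ T → trans (ℚ.*-comm 1ℚ (hasSize K T)) (cong (λ b → hasSize K T * 𝟙 b) (sym (disjoint-⊥ T)))) ⟩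
      ∑ (subsets P) (λ T → hasSize K T * D Subset.⊥ T) ≡⟨ count-disjoint {P} K Subset.⊥ ⟩
      ι ((P ∸ ∣ Subset.⊥ {P} ∣) C K)                  ≡⟨ cong (λ s → ι ((P ∸ s) C K)) (∣⊥∣≡0 P) ⟩
      ι (P C K)                                       ∎
      where open ≡-Reasoning

  Ω : ℚ
  Ω = ι (P C K)

  0<Ω : 0ℚ < Ω
  0<Ω = 0<ι (C-positive P K K≤P)

  private
    1≤N : 1 ℕ.≤ N
    1≤N = ℕ.n≢0⇒n>0 λ N≡0 → ℚ.<⇒≢ 0<Ω (trans (sym ι-0) (trans (cong ι (sym N≡0)) ιN))

    u : ℚ
    u = 1 ÷ N

    uΩ : u * Ω ≡ 1ℚ
    uΩ = trans (cong (u *_) (sym ιN)) (trans (÷-* 1 1≤N) ι-1)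

    0≤u : 0ℚ ≤ u
    0≤u = cancel-≤ Ω 0<Ω (subst₂ _≤_ (sym (ℚ.*-zeroˡ Ω)) (sym uΩ) 0≤1ℚ)

    mass≡ : ∀ T → uniformMass K P T ≡ u * hasSize K T
    mass≡ T with does (∣ T ∣ ℕ.≟ K)
    ... | true  = sym (ℚ.*-identityʳ u)
    ... | false = sym (ℚ.*-zeroʳ u)

    total : ∑ (subsets P) (uniformMass K P) ≡ 1ℚ
    total = begin
      ∑ (subsets P) (uniformMass K P)             ≡⟨ ∑.cong-≗ (subsets P) mass≡ ⟩
      ∑ (subsets P) (λ T → u * hasSize K T)       ≡⟨ ∑.scale (subsets P) u (hasSize K) ⟩
      u * ∑ (subsets P) (hasSize K)               ≡⟨ cong (u *_) (∑.cong-≗ (subsets P) (λ T → ℚ.*-identityˡ (hasSize K T))) ⟨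
      u * ∑ (subsets P) (λ T → 1ℚ * hasSize K T)  ≡⟨ cong (u *_) (trans (ι-length rings) (∑-filter (λ T → ∣ T ∣ ℕ.≟ K) (subsets P) (λ _ → 1ℚ))) ⟨
      u * ι N                                     ≡⟨ trans (÷-* 1 1≤N) ι-1 ⟩
      1ℚ                                          ∎
      where open ≡-Reasoning

    supported : ∀ T → ∣ T ∣ ≡ K ⊎ uniformMass K P T ≡ 0ℚ
    supported T with ∣ T ∣ ℕ.≟ K
    ... | yes eq = inj₁ eq
    ... | no  ≢K = inj₂ (cong (λ b → if b then u else 0ℚ) (dec-false (∣ T ∣ ℕ.≟ K) ≢K))

  ring : Expectation (Subset P)
  ring = weighted (subsets P) (uniformMass K P) (λ T → ∣ T ∣ ≡ K)
    (λ T → subst (0ℚ ≤_) (sym (mass≡ T)) (0≤* 0≤u (0≤𝟙 (does (∣ T ∣ ℕ.≟ K))))) supported total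

  open Expectation ring

  φ : ℕ → ℚ
  φ s = u * ι ((P ∸ s) C K)

  φΩ : ∀ s → φ s * Ω ≡ ι ((P ∸ s) C K)
  φΩ s = trans (R.solve 3 (λ u a o → u R.:* a R.:* o R.:= u R.:* o R.:* a) refl u (ι ((P ∸ s) C K)) Ω)
    (trans (cong (_* ι ((P ∸ s) C K)) uΩ) (ℚ.*-identityˡ _))

  𝔼D : ∀ S → 𝔼 (D S) ≡ φ ∣ S ∣
  𝔼D S = trans (∑.cong-≗ (subsets P) λ T → trans (cong (_* D S T) (mass≡ T)) (ℚ.*-assoc u (hasSize K T) (D S T)))
    (trans (∑.scale (subsets P) u _) (cong (u *_) (count-disjoint K S)))

  -- The case distinction in `q` is absorbed by the binomial: if P < 2K then P - K < K and the
  -- coefficient is 0.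
  q≡φ : q K P ≡ φ K
  q≡φ = cancel-≡ Ω 0<Ω (trans lemma (sym (φΩ K)))
    where
    z : ℚ
    z = ((P ∸ K) C K) ÷ (P C K)
    lemma : q K P * Ω ≡ ι ((P ∸ K) C K)
    lemma with 2 ℕ.* K ℕ.≤? P
    ... | yes 2K≤P = trans (cong (λ b → (if b then z else 0ℚ) * Ω) (dec-true (2 ℕ.* K ℕ.≤? P) 2K≤P))
                       (÷-* ((P ∸ K) C K) (C-positive P K K≤P))
    ... | no  2K≰P = begin
      q K P * Ω              ≡⟨ cong (λ b → (if b then z else 0ℚ) * Ω) (dec-false (2 ℕ.* K ℕ.≤? P) 2K≰P) ⟩
      0ℚ * Ω                 ≡⟨ ℚ.*-zeroˡ Ω ⟩
      0ℚ                     ≡⟨ ι-0 ⟨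
      ι 0                    ≡⟨ cong ι (k>n⇒nCk≡0 (ℕ.+-cancelʳ-< K (P ∸ K) K (subst₂ ℕ._<_
                                 (sym (ℕ.m∸n+n≡m K≤P)) (cong (K ℕ.+_) (ℕ.+-identityʳ K)) (ℕ.≰⇒> 2K≰P)))) ⟨
      ι ((P ∸ K) C K)        ∎
      where open ≡-Reasoning

  -- `r` is the chance that a ring misses two given disjoint rings. `β` is the inclusion-exclusion
  -- value 1 - 3Q + 3Q² - Qr of the triangle probability, grouped in the way it arises from
  -- averaging `𝔼χ`.
  Q r p β : ℚ
  Q = q K P
  r = φ (K ℕ.+ K)
  p = 1ℚ - Q
  β = p * (1ℚ - Q - Q) + Q * Q - Q * r

  private
    𝔼D-ring : ∀ S → ∣ S ∣ ≡ K → 𝔼 (D S) ≡ Q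
    𝔼D-ring S eq = trans (𝔼D S) (trans (cong φ eq) (sym q≡φ))

    𝔼-complement : ∀ f → 𝔼 (λ x → 1ℚ - f x) ≡ 1ℚ - 𝔼 f
    𝔼-complement f = trans (subtract (λ _ → 1ℚ) f) (cong (_- 𝔼 f) (constant 1ℚ))

    -- The joint miss `j` depends on the size of `a ∪ b`, so it is evaluated only where `D a b`
    -- multiplies it and the size is 2K. The bare copy stays unevaluated until `b` is averaged as
    -- well.
    𝔼χ : ∀ a b → ∣ a ∣ ≡ K → ∣ b ∣ ≡ K →
      𝔼 (χ a b) ≡ (1ℚ - D a b) * (1ℚ - Q - Q) + 𝔼 (λ c → D a c * D b c) - D a b * r
    𝔼χ a b sa sb = begin
      𝔼 (χ a b)
        ≡⟨ ext (λ c → expand (D a b) (D b c) (D a c)) ⟩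
      𝔼 (λ c → (1ℚ - D a b) * ((1ℚ - D b c) - D a c + D a c * D b c))
        ≡⟨ scale (1ℚ - D a b) _ ⟩
      (1ℚ - D a b) * 𝔼 (λ c → (1ℚ - D b c) - D a c + D a c * D b c)
        ≡⟨ cong ((1ℚ - D a b) *_) (trans (add (λ c → (1ℚ - D b c) - D a c) (λ c → D a c * D b c))
             (cong (_+ j) (trans (subtract (λ c → 1ℚ - D b c) (D a)) (cong₂ _-_
               (trans (𝔼-complement (D b)) (cong (λ z → 1ℚ - z) (𝔼D-ring b sb))) (𝔼D-ring a sa))))) ⟩
      (1ℚ - D a b) * (1ℚ - Q - Q + j)
        ≡⟨ regroup (D a b) Q j ⟩
      (1ℚ - D a b) * (1ℚ - Q - Q) + j - D a b * j
        ≡⟨ cong (λ z → (1ℚ - D a b) * (1ℚ - Q - Q) + j - z) (begin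
             D a b * j                       ≡⟨ cong (D a b *_) (trans (ext λ c → sym (D-∪ a b c)) (𝔼D (a ∪ b))) ⟩
             D a b * φ ∣ a ∪ b ∣             ≡⟨ D-∪-size φ a b ⟩
             D a b * φ (∣ a ∣ ℕ.+ ∣ b ∣)     ≡⟨ cong₂ (λ s t → D a b * φ (s ℕ.+ t)) sa sb ⟩
             D a b * r                       ∎) ⟩
      (1ℚ - D a b) * (1ℚ - Q - Q) + j - D a b * r ∎
      where
      open ≡-Reasoning
      j : ℚ
      j = 𝔼 (λ c → D a c * D b c)
      expand : ∀ x y z → (1ℚ - x) * (1ℚ - y) * (1ℚ - z) ≡ (1ℚ - x) * ((1ℚ - y) - z + z * y)
      expand = R.solve 3 (λ x y z → let o = R.con 1ℚ in
        (o R.:- x) R.:* (o R.:- y) R.:* (o R.:- z) R.:= (o R.:- x) R.:* ((o R.:- y) R.:- z R.:+ z R.:* y)) refl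
      regroup : ∀ x q j → (1ℚ - x) * (1ℚ - q - q + j) ≡ (1ℚ - x) * (1ℚ - q - q) + j - x * j
      regroup = R.solve 3 (λ x q j → let o = R.con 1ℚ in
        (o R.:- x) R.:* (o R.:- q R.:- q R.:+ j) R.:= (o R.:- x) R.:* (o R.:- q R.:- q) R.:+ j R.:- x R.:* j) refl

  point≡β : ∀ a → ∣ a ∣ ≡ K → 𝔼 (λ b → 𝔼 (χ a b)) ≡ β
  point≡β a sa = begin
    𝔼 (λ b → 𝔼 (χ a b))
      ≡⟨ cong-on (λ b sb → 𝔼χ a b sa sb) ⟩
    𝔼 (λ b → (1ℚ - D a b) * e + 𝔼 (λ c → D a c * D b c) - D a b * r)
      ≡⟨ trans (subtract (λ b → (1ℚ - D a b) * e + 𝔼 (λ c → D a c * D b c)) (λ b → D a b * r)) (cong₂ _-_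
           (trans (add (λ b → (1ℚ - D a b) * e) (λ b → 𝔼 (λ c → D a c * D b c))) (cong₂ _+_ left middle)) right) ⟩
    β ∎
    where
    open ≡-Reasoning
    e : ℚ
    e = 1ℚ - Q - Q
    scaleʳ : ∀ f k → 𝔼 (λ b → f b * k) ≡ 𝔼 f * k
    scaleʳ f k = trans (ext λ b → ℚ.*-comm (f b) k) (trans (scale k f) (ℚ.*-comm k (𝔼 f)))
    left : 𝔼 (λ b → (1ℚ - D a b) * e) ≡ p * e
    left = trans (scaleʳ _ e) (cong (_* e) (trans (𝔼-complement (D a)) (cong (λ z → 1ℚ - z) (𝔼D-ring a sa))))
    right : 𝔼 (λ b → D a b * r) ≡ Q * r
    right = trans (scaleʳ _ r) (cong (_* r) (𝔼D-ring a sa))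
    -- With `c` averaged last, its two disjointness events are independent given `c`, and each has
    -- probability Q.
    middle : 𝔼 (λ b → 𝔼 (λ c → D a c * D b c)) ≡ Q * Q
    middle = trans (fubini linear (λ c b → D a c * D b c))
      (trans (cong-on λ c sc → trans (scale (D a c) (λ b → D b c)) (cong (D a c *_) (trans (ext λ b → D-comm b c) (𝔼D-ring c sc))))
        (trans (scaleʳ (D a) Q) (cong (_* Q) (𝔼D-ring a sa))))

  pair≤p : ∀ a b → ∣ a ∣ ≡ K → 𝔼 (χ a b) ≤ p
  pair≤p a b sa = ℚ.≤-trans (mono λ c _ → χ≤1-D a b c)
    (ℚ.≤-reflexive (trans (𝔼-complement (D a)) (cong (λ z → 1ℚ - z) (𝔼D-ring a sa))))

  0≤φ : ∀ s → 0ℚ ≤ φ s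
  0≤φ s = 0≤* 0≤u (0≤ι _)

  0≤Q : 0ℚ ≤ Q
  0≤Q = subst (0ℚ ≤_) (sym q≡φ) (0≤φ K)

  private
    Ω*Ω : ∀ s t → φ s * φ t * (Ω * Ω) ≡ ι ((P ∸ s) C K) * ι ((P ∸ t) C K)
    Ω*Ω s t = trans (R.solve 3 (λ a b o → a R.:* b R.:* (o R.:* o) R.:= a R.:* o R.:* (b R.:* o)) refl (φ s) (φ t) Ω)
      (cong₂ _*_ (φΩ s) (φΩ t))

  r≤Q² : r ≤ Q * Q
  r≤Q² = subst (λ z → r ≤ z * z) (sym q≡φ) (cancel-≤ (Ω * Ω) (0<* 0<Ω 0<Ω) (subst₂ _≤_
    (trans (ι-* _ _) (trans (cong (_* Ω) (sym (φΩ (K ℕ.+ K)))) (ℚ.*-assoc r Ω Ω)))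
    (trans (ι-* _ _) (sym (Ω*Ω K K)))
    (ι-mono-≤ (C-log-concave P K K))))

  -- Against (1 - Q)³ = 1 - 3Q + 3Q² - Q³ the difference is Q(Q² - r), nonnegative by log-concavity:
  -- the three edges are positively correlated.
  p³≤β : p * p * p ≤ β
  p³≤β = ≤-by (0≤* 0≤Q (≤⇒0≤ r≤Q²)) (eq Q r)
    where
    eq : ∀ q r → q * (q * q - r) ≡ ((1ℚ - q) * (1ℚ - q - q) + q * q - q * r) - (1ℚ - q) * (1ℚ - q) * (1ℚ - q)
    eq = R.solve 2 (λ q r → let o = R.con 1ℚ in q R.:* (q R.:* q R.:- r) R.:=
      ((o R.:- q) R.:* (o R.:- q R.:- q) R.:+ q R.:* q R.:- q R.:* r) R.:- (o R.:- q) R.:* (o R.:- q) R.:* (o R.:- q)) refl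

  private
    π k : ℚ
    π = ι P
    k = ι K

    0<π : 0ℚ < π
    0<π = 0<ι 1≤P

    ιP∸K : ι (P ∸ K) ≡ π - k
    ιP∸K = trans (sym (cancel (ι (P ∸ K)) k)) (cong (_- k) (trans (sym (ι-+ (P ∸ K) K)) (cong ι (ℕ.m∸n+n≡m K≤P))))
      where
      cancel : ∀ a b → (a + b) - b ≡ a
      cancel = R.solve 2 (λ a b → (a R.:+ b) R.:- b R.:= a) refl

  x y : ℚ
  x = (K ^ 2) ÷ P
  y = K ÷ P

  private
    xπ : x * π ≡ k * k
    xπ = trans (÷-* (K ^ 2) 1≤P) (trans (cong (λ z → ι (K ℕ.* z)) (ℕ.*-identityʳ K)) (ι-* K K))

    yπ : y * π ≡ k
    yπ = ÷-* K 1≤P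

  0≤x : 0ℚ ≤ x
  0≤x = cancel-≤ π 0<π (subst₂ _≤_ (sym (ℚ.*-zeroˡ π)) (sym xπ) (square≥0 k))

  0≤y : 0ℚ ≤ y
  0≤y = cancel-≤ π 0<π (subst₂ _≤_ (sym (ℚ.*-zeroˡ π)) (sym yπ) (0≤ι K))

  τ≡ : τ K P ≡ x * y + x * x * x
  τ≡ = cong (_+ x * x * x) (cancel-≡ {(K ^ 3) ÷ (P ^ 2)} {x * y} (π * π) (0<* 0<π 0<π) (begin
    (K ^ 3) ÷ (P ^ 2) * (π * π)  ≡⟨ cong ((K ^ 3) ÷ (P ^ 2) *_) ι-sq ⟨
    (K ^ 3) ÷ (P ^ 2) * ι (P ^ 2) ≡⟨ ÷-* (K ^ 3) (ℕ.*-mono-≤ 1≤P (ℕ.≤-trans 1≤P (ℕ.≤-reflexive (sym (ℕ.*-identityʳ P))))) ⟩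
    ι (K ^ 3)                    ≡⟨ trans (cong (λ z → ι (K ℕ.* (K ℕ.* z))) (ℕ.*-identityʳ K)) (trans (ι-* K _) (cong (k *_) (ι-* K K))) ⟩
    k * (k * k)                  ≡⟨ cong₂ _*_ yπ xπ ⟨
    y * π * (x * π)              ≡⟨ R.solve 3 (λ x y p → y R.:* p R.:* (x R.:* p) R.:= x R.:* y R.:* (p R.:* p)) refl x y π ⟩
    x * y * (π * π)              ∎))
    where
    open ≡-Reasoning
    ι-sq : ι (P ^ 2) ≡ π * π
    ι-sq = trans (cong (λ z → ι (P ℕ.* z)) (ℕ.*-identityʳ P)) (ι-* P P)

  φ1 : 1ℚ - φ 1 ≡ y
  φ1 = cancel-≡ (π * Ω) (0<* 0<π 0<Ω) (begin
    (1ℚ - φ 1) * (π * Ω)          ≡⟨ R.solve 3 (λ f p o → (R.con 1ℚ R.:- f) R.:* (p R.:* o) R.:= p R.:* o R.:- f R.:* o R.:* p) refl (φ 1) π Ω ⟩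
    π * Ω - φ 1 * Ω * π           ≡⟨ cong (λ z → π * Ω - z * π) (φΩ 1) ⟩
    π * Ω - ι ((P ∸ 1) C K) * π   ≡⟨ cong (λ z → π * Ω - z) (trans (sym (ι-* _ P)) (trans (cong ι (C-absorb P K 1≤P)) (trans (ι-* _ _) (cong (Ω *_) ιP∸K)))) ⟩
    π * Ω - Ω * (π - k)           ≡⟨ cong (λ k → π * Ω - Ω * (π - k)) yπ ⟨
    π * Ω - Ω * (π - y * π)       ≡⟨ R.solve 3 (λ y p o → p R.:* o R.:- o R.:* (p R.:- y R.:* p) R.:= y R.:* (p R.:* o)) refl y π Ω ⟩
    y * (π * Ω)                   ∎)
    where open ≡-Reasoning

  -- Given that `a` and `b` meet, fix one common key. The third ring contains it with probability
  -- K/P and then meets both.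
  py≤β : p * y ≤ β
  py≤β = begin
    p * y                                     ≡⟨ constant (p * y) ⟨
    𝔼 (λ a → p * y)                           ≡⟨ cong-on (λ a sa → trans (ℚ.*-comm p y) (trans (cong (y *_) (sym (trans (𝔼-complement (D a)) (cong (λ z → 1ℚ - z) (𝔼D-ring a sa))))) (sym (scale y (λ b → 1ℚ - D a b))))) ⟩
    𝔼 (λ a → 𝔼 (λ b → y * (1ℚ - D a b)))      ≤⟨ mono (λ a _ → mono λ b _ → ℚ.≤-trans (ℚ.≤-reflexive (ℚ.*-comm y (1ℚ - D a b))) (through a b)) ⟩
    𝔼 (λ a → 𝔼 (λ b → 𝔼 (χ a b)))             ≡⟨ trans (cong-on point≡β) (constant β) ⟩
    β                                         ∎
    where
    open ℚ.≤-Reasoning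
    through : ∀ a b → (1ℚ - D a b) * y ≤ 𝔼 (χ a b)
    through a b with disjoint a b in eq
    ... | true  = subst (_≤ 𝔼 (λ c → (1ℚ - 1ℚ) * (1ℚ - D b c) * (1ℚ - D a c))) (sym (ℚ.*-zeroˡ y))
      (nonNegative λ c _ → ℚ.≤-reflexive (sym (R.solve 2 (λ s t → (R.con 1ℚ R.:- R.con 1ℚ) R.:* s R.:* t R.:= R.con 0ℚ) refl (1ℚ - D b c) (1ℚ - D a c))))
    ... | false with U , ∣U∣≡1 , h ← common-key a b eq = begin
      (1ℚ - 0ℚ) * y             ≡⟨ ℚ.*-identityˡ y ⟩
      y                         ≡⟨ φ1 ⟨
      1ℚ - φ 1                  ≡⟨ trans (𝔼-complement (D U)) (cong (λ z → 1ℚ - z) (trans (𝔼D U) (cong φ ∣U∣≡1))) ⟨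
      𝔼 (λ c → 1ℚ - D U c)      ≤⟨ mono (λ c _ → pointwise c) ⟩
      𝔼 (λ c → (1ℚ - 0ℚ) * (1ℚ - D b c) * (1ℚ - D a c)) ∎
      where
      nonneg : ∀ s t → 0ℚ ≤ (1ℚ - 0ℚ) * (1ℚ - 𝟙 s) * (1ℚ - 𝟙 t)
      nonneg true  true  = ℚ.≤-refl
      nonneg true  false = ℚ.≤-refl
      nonneg false true  = ℚ.≤-refl
      nonneg false false = 0≤1ℚ
      pointwise : ∀ c → 1ℚ - D U c ≤ (1ℚ - 0ℚ) * (1ℚ - D b c) * (1ℚ - D a c)
      pointwise c with disjoint U c in Uc
      ... | true  = nonneg (disjoint b c) (disjoint a c)
      ... | false with ac , bc ← h c Uc rewrite ac | bc = ℚ.≤-refl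

  x≤p[1+x] : x ≤ p * (1ℚ + x)
  x≤p[1+x] = cancel-≤ (π * Ω) (0<* 0<π 0<Ω) (≤-by (≤⇒0≤ bound) (begin
    π * Ω - (π + k * k) * ι ((P ∸ K) C K)   ≡⟨ cong₂ (λ w z → π * Ω - (π + w) * z) xπ (trans (cong (_* Ω) q≡φ) (φΩ K)) ⟨
    π * Ω - (π + x * π) * (Q * Ω)           ≡⟨ eq Q x π Ω ⟩
    p * (1ℚ + x) * (π * Ω) - x * (π * Ω)    ∎))
    where
    open ≡-Reasoning
    bound : (π + k * k) * ι ((P ∸ K) C K) ≤ π * Ω
    bound = subst₂ _≤_
      (trans (ι-* _ _) (cong (_* ι ((P ∸ K) C K)) (trans (ι-+ P _) (cong (π +_) (ι-* K K)))))
      (ι-* P _) (ι-mono-≤ (C-decay P K K))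
    eq : ∀ q x p o → p * o - (p + x * p) * (q * o) ≡ (1ℚ - q) * (1ℚ + x) * (p * o) - x * (p * o)
    eq = R.solve 4 (λ q x p o → let i = R.con 1ℚ in p R.:* o R.:- (p R.:+ x R.:* p) R.:* (q R.:* o)
      R.:= (i R.:- q) R.:* (i R.:+ x) R.:* (p R.:* o) R.:- x R.:* (p R.:* o)) refl

-- Triangles in the random key graph

-- Identifies iterated expectations with sums against the product mass that defines `ℙ`.
𝔼-power : ∀ {A : Set} (X : Expectation A) xs (w : A → ℚ) → let open Expectation in
  (∀ f → 𝔼 X f ≡ ∑ xs (λ x → w x * f x)) → ∀ n f →
  𝔼 (power X n) f ≡ ∑ (vectors xs n) (λ v → Vec.foldr′ _*_ 1ℚ (Vec.map w v) * f v)
𝔼-power X xs w 𝔼≡ zero    f = trans (sym (ℚ.*-identityˡ (f []))) (sym (ℚ.+-identityʳ (1ℚ * f [])))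
𝔼-power {A} X xs w 𝔼≡ (suc n) f = begin
  X.𝔼 (λ x → Xⁿ.𝔼 (λ v → f (x ∷ v)))
    ≡⟨ 𝔼≡ (λ x → Xⁿ.𝔼 (λ v → f (x ∷ v))) ⟩
  ∑ xs (λ x → w x * Xⁿ.𝔼 (λ v → f (x ∷ v)))
    ≡⟨ ∑.cong-≗ xs (λ x → trans (cong (w x *_) (𝔼-power X xs w 𝔼≡ n (λ v → f (x ∷ v))))
         (trans (sym (∑.scale (vectors xs n) (w x) (λ v → W v * f (x ∷ v))))
           (∑.cong-≗ (vectors xs n) (λ v → sym (ℚ.*-assoc (w x) (W v) (f (x ∷ v))))))) ⟩
  ∑ xs (λ x → ∑ (vectors xs n) (λ v → w x * W v * f (x ∷ v)))
    ≡⟨ ∑-cartesianProductWith _∷_ xs (vectors xs n) (λ v → W v * f v) ⟨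
  ∑ (vectors xs (suc n)) (λ v → W v * f v) ∎
  where
  open ≡-Reasoning
  module X  = Expectation X
  module Xⁿ = Expectation (power X n)
  W : ∀ {k} → Vec A k → ℚ
  W v = Vec.foldr′ _*_ 1ℚ (Vec.map w v)

↑ˡ≢↑ʳ : ∀ {m n} (i : Fin m) (j : Fin n) → i ↑ˡ n ≢ m ↑ʳ j
↑ˡ≢↑ʳ (Fin.suc i) j eq = ↑ˡ≢↑ʳ i j (Fin.suc-injective eq)

-- The three nodes are distinct because they come from different blocks; the leftover nodes `z` play
-- no part in the triangle.
blocks-triangle : ∀ {P m r} (u v w : Vec (Subset P) m) (z : Vec (Subset P) r) i j k →
  Nonempty (lookup u i ∩ lookup v j) → Nonempty (lookup v j ∩ lookup w k) → Nonempty (lookup u i ∩ lookup w k) →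
  HasTriangle (u Vec.++ (v Vec.++ (w Vec.++ z)))
blocks-triangle {P} {m} {r} u v w z i j k uv vw uw = a , b , c
  , (↑ˡ≢↑ʳ i _ , subst₂ Meet (sym ua) (sym vb) uv)
  , ((λ eq → ↑ˡ≢↑ʳ j (k ↑ˡ _) (Fin.↑ʳ-injective m _ _ eq)) , subst₂ Meet (sym vb) (sym wc) vw)
  , (↑ˡ≢↑ʳ i _ , subst₂ Meet (sym ua) (sym wc) uw)
  where
  Meet : Subset P → Subset P → Set
  Meet S T = Nonempty (S ∩ T)
  ω = u Vec.++ (v Vec.++ (w Vec.++ z))
  a b c : Fin (m ℕ.+ (m ℕ.+ (m ℕ.+ r)))
  a = i ↑ˡ _
  b = m ↑ʳ (j ↑ˡ _)
  c = m ↑ʳ (m ↑ʳ (k ↑ˡ _))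
  ua : lookup ω a ≡ lookup u i
  ua = lookup-++ˡ u _ i
  vb : lookup ω b ≡ lookup v j
  vb = trans (lookup-++ʳ u _ _) (lookup-++ˡ v _ j)
  wc : lookup ω c ≡ lookup w k
  wc = trans (lookup-++ʳ u _ _) (trans (lookup-++ʳ v _ _) (lookup-++ˡ w _ k))

-- The sum 1 + 3 + 3 of the coefficients in `variance`.
7ℚ : ℚ
7ℚ = 1ℚ + (1ℚ + 1ℚ + 1ℚ) + (1ℚ + 1ℚ + 1ℚ)

module Chebyshev (K P : ℕ) (1≤P : 1 ℕ.≤ P) (K≤P : K ℕ.≤ P) where
  open KeyRing K P 1≤P K≤P
  open Expectation using (𝔼)

  triangle : ∀ {n} → Outcome n P → ℚ
  triangle ω = 𝟙 (does (hasTriangle? ω))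

  ℙ≡𝔼 : ∀ n → ℙ[triangle] n K P ≡ 𝔼 (power ring n) triangle
  ℙ≡𝔼 n = trans (∑-filter hasTriangle? (vectors (subsets P) n) (mass n K P)) (sym (𝔼-power ring (subsets P) (uniformMass K P) (λ _ → refl) n triangle))

  1-ℙ≡𝔼 : ∀ n → 1ℚ - ℙ[triangle] n K P ≡ 𝔼 (power ring n) (λ ω → 1ℚ - triangle ω)
  1-ℙ≡𝔼 n = trans (cong₂ _-_ (sym (Expectation.total (power ring n))) (ℙ≡𝔼 n)) (sym (Expectation.subtract (power ring n) _ _))

  0≤1-ℙ : ∀ n → 0ℚ ≤ 1ℚ - ℙ[triangle] n K P
  0≤1-ℙ n = subst (0ℚ ≤_) (sym (1-ℙ≡𝔼 n)) (Expectation.nonNegative (power ring n) λ ω _ → ≤⇒0≤ (𝟙≤1 (does (hasTriangle? ω))))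

  module _ (m r : ℕ) where
    open Moments ring m using (μ; 0≤μ; sq; 𝔼ᵐ; vsum₃; module Symmetric)
    open Symmetric χ p β χ-swap₁₂ χ-swap₂₃ χ-idempotent pair≤p point≡β
    private
      module Xₘ = Expectation (power ring m)
      module Xᵣ = Expectation (power ring r)
      M : ℚ
      M = μ * μ * μ * β

    -- Chebyshev's inequality pointwise: without a triangle the count `T` is 0, so its squared
    -- deviation is M². With a triangle the left side is 0.
    no-triangle : ∀ u v w (z : Vec (Subset P) r) → sq M * (1ℚ - triangle (u Vec.++ (v Vec.++ (w Vec.++ z)))) ≤ sq (T u v w - M)
    no-triangle u v w z with hasTriangle? (u Vec.++ (v Vec.++ (w Vec.++ z)))
    ... | yes _  = subst (_≤ sq (T u v w - M)) (sym (ℚ.*-zeroʳ (sq M))) (square≥0 (T u v w - M))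
    ... | no  ¬t = ℚ.≤-reflexive (begin
      sq M * 1ℚ           ≡⟨ R.solve 1 (λ m → m R.:* m R.:* R.con 1ℚ R.:= (R.con 0ℚ R.:- m) R.:* (R.con 0ℚ R.:- m)) refl M ⟩
      sq (0ℚ - M)         ≡⟨ cong (λ t → sq (t - M)) T≡0 ⟨
      sq (T u v w - M)    ∎)
      where
      open ≡-Reasoning
      T≡0 : T u v w ≡ 0ℚ
      T≡0 = vsum-zero w λ k → vsum-zero v λ j → vsum-zero u λ i →
        χ-vanish (lookup u i) (lookup v j) (lookup w k) λ (uv , vw , uw) → ¬t (blocks-triangle u v w z i j k uv vw uw)

    chebyshev : sq M * (1ℚ - ℙ[triangle] (m ℕ.+ (m ℕ.+ (m ℕ.+ r))) K P)
      ≤ M + (1ℚ + 1ℚ + 1ℚ) * (μ * μ * μ * μ * p * β) + (1ℚ + 1ℚ + 1ℚ) * (μ * μ * μ * μ * μ * β * β)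
    chebyshev = begin
      sq M * (1ℚ - ℙ[triangle] n K P)
        ≡⟨ trans (cong (sq M *_) (1-ℙ≡𝔼 n)) (sym (Expectation.scale (power ring n) (sq M) (λ ω → 1ℚ - triangle ω))) ⟩
      𝔼 (power ring n) (λ ω → sq M * (1ℚ - triangle ω))
        ≡⟨ trans (power-++ ring m _ _) (Xₘ.ext λ u → trans (power-++ ring m _ _) (Xₘ.ext λ v → power-++ ring m r _)) ⟩
      𝔼³ (λ u v w → Xᵣ.𝔼 (λ z → sq M * (1ℚ - triangle (u Vec.++ (v Vec.++ (w Vec.++ z))))))
        ≤⟨ Xₘ.mono (λ u _ → Xₘ.mono λ v _ → Xₘ.mono λ w _ → ℚ.≤-trans (Xᵣ.mono λ z _ → no-triangle u v w z)
             (ℚ.≤-reflexive (Xᵣ.constant (sq (T u v w - M))))) ⟩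
      𝔼³ (λ u v w → sq (T u v w - M))
        ≤⟨ variance ⟩
      M + (1ℚ + 1ℚ + 1ℚ) * (μ * μ * μ * μ * p * β) + (1ℚ + 1ℚ + 1ℚ) * (μ * μ * μ * μ * μ * β * β) ∎
      where
      open ℚ.≤-Reasoning
      n : ℕ
      n = m ℕ.+ (m ℕ.+ (m ℕ.+ r))

  0≤p : 0ℚ ≤ p
  0≤p = cancel-≤ (1ℚ + x) (ℚ.<-≤-trans (ℚ.positive⁻¹ 1ℚ) (≤-by 0≤x (R.solve 1 (λ x → x R.:= (R.con 1ℚ R.:+ x) R.:- R.con 1ℚ) refl x)))
    (subst (_≤ p * (1ℚ + x)) (sym (ℚ.*-zeroˡ (1ℚ + x))) (ℚ.≤-trans 0≤x x≤p[1+x]))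

  0≤β : 0ℚ ≤ β
  0≤β = ℚ.≤-trans (0≤* 0≤p 0≤y) py≤β

  p≤1 : p ≤ 1ℚ
  p≤1 = ≤-by 0≤Q (R.solve 1 (λ q → q R.:= R.con 1ℚ R.:- (R.con 1ℚ R.:- q)) refl Q)

  -- Each of the last three hypotheses absorbs `L` into one variance term: L·M ≤ M², L·μ⁴pβ ≤ M² and
  -- L·μ⁵β² ≤ M². Cancelling M² leaves the coefficient sum 7.
  large-moments : ∀ n {L} → let μ = ι (n ℕ./ 3) in
    0ℚ < L → L ≤ μ → L * p ≤ μ * μ * β → L ≤ μ * μ * μ * β →
    L * (1ℚ - ℙ[triangle] n K P) ≤ 7ℚ
  large-moments n {L} 0<L L≤μ Lp≤ L≤M = cancel-≤ (M * M) (0<* 0<M 0<M) (begin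
    L * f * (M * M)
      ≡⟨ R.solve 3 (λ l f m → l R.:* f R.:* (m R.:* m) R.:= l R.:* (m R.:* m R.:* f)) refl L f M ⟩
    L * (M * M * f)
      ≤⟨ ℚ.*-monoˡ-≤-nonNeg L {{ℚ.nonNegative (ℚ.<⇒≤ 0<L)}} cheb ⟩
    L * (M + three * (μ * μ * μ * μ * p * β) + three * (μ * μ * μ * μ * μ * β * β))
      ≤⟨ ≤-by (0≤+ (0≤+ (0≤* (≤⇒0≤ L≤M) 0≤M) (0≤* 0≤3 (0≤* (0≤* (0≤* 0≤μ 0≤μ) (≤⇒0≤ Lp≤)) (0≤* (0≤* 0≤μ 0≤μ) 0≤β))))
                   (0≤* 0≤3 (0≤* (≤⇒0≤ L≤μ) (0≤* (0≤* (0≤* (0≤* 0≤μ 0≤μ) (0≤* 0≤μ 0≤μ)) 0≤μ) (0≤* 0≤β 0≤β)))))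
           (collect L μ p β) ⟩
    7ℚ * (M * M) ∎)
    where
    open ℚ.≤-Reasoning
    m : ℕ
    m = n ℕ./ 3
    μ M f three : ℚ
    μ = ι m
    M = μ * μ * μ * β
    f = 1ℚ - ℙ[triangle] n K P
    three = 1ℚ + 1ℚ + 1ℚ
    0≤3 : 0ℚ ≤ three
    0≤3 = 0≤+ (0≤+ 0≤1ℚ 0≤1ℚ) 0≤1ℚ
    0≤μ : 0ℚ ≤ μ
    0≤μ = 0≤ι m
    0<M : 0ℚ < M
    0<M = ℚ.<-≤-trans 0<L L≤M
    0≤M : 0ℚ ≤ M
    0≤M = ℚ.<⇒≤ 0<M
    split : m ℕ.+ (m ℕ.+ (m ℕ.+ n ℕ.% 3)) ≡ n
    split = sym (trans (ℕ.m≡m%n+[m/n]*n n 3) (rearrange (n ℕ.% 3) m))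
      where
      rearrange : ∀ r m → r ℕ.+ m ℕ.* 3 ≡ m ℕ.+ (m ℕ.+ (m ℕ.+ r))
      rearrange = S.solve 2 (λ r m → r S.:+ m S.:* S.con 3 S.:= m S.:+ (m S.:+ (m S.:+ r))) refl
    cheb : M * M * f ≤ M + three * (μ * μ * μ * μ * p * β) + three * (μ * μ * μ * μ * μ * β * β)
    cheb = subst (λ k → M * M * (1ℚ - ℙ[triangle] k K P) ≤ M + three * (μ * μ * μ * μ * p * β) + three * (μ * μ * μ * μ * μ * β * β))
      split (chebyshev m (n ℕ.% 3))
    collect : ∀ l m p b → (m * m * m * b - l) * (m * m * m * b) + three * (m * m * (m * m * b - l * p) * (m * m * b))
      + three * ((m - l) * (m * m * (m * m) * m * (b * b)))
      ≡ 7ℚ * (m * m * m * b * (m * m * m * b)) - l * (m * m * m * b + three * (m * m * m * m * p * b) + three * (m * m * m * m * m * b * b))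
    collect = R.solve 4 (λ l m p b → let infixl 6 _⊕_ _⊖_; infixl 7 _⊗_ ; _⊕_ = R._:+_ ; _⊗_ = R._:*_ ; _⊖_ = R._:-_ ; t = R.con three in
      (m ⊗ m ⊗ m ⊗ b ⊖ l) ⊗ (m ⊗ m ⊗ m ⊗ b) ⊕ t ⊗ (m ⊗ m ⊗ (m ⊗ m ⊗ b ⊖ l ⊗ p) ⊗ (m ⊗ m ⊗ b))
      ⊕ t ⊗ ((m ⊖ l) ⊗ (m ⊗ m ⊗ (m ⊗ m) ⊗ m ⊗ (b ⊗ b)))
      R.:= R.con 7ℚ ⊗ (m ⊗ m ⊗ m ⊗ b ⊗ (m ⊗ m ⊗ m ⊗ b)) ⊖ l ⊗ (m ⊗ m ⊗ m ⊗ b ⊕ t ⊗ (m ⊗ m ⊗ m ⊗ m ⊗ p ⊗ b) ⊕ t ⊗ (m ⊗ m ⊗ m ⊗ m ⊗ m ⊗ b ⊗ b))) refl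

-- Asymptotics

archimedean-* : ∀ {c} L → 0ℚ < c → ∃[ N ] L ≤ ι N * c
archimedean-* {c} L 0<c = let (N , h) = archimedean (L * 1/c) in N , (begin
  L                ≡⟨ trans (cong (L *_) (ℚ.*-inverseˡ c)) (ℚ.*-identityʳ L) ⟨
  L * (1/c * c)    ≡⟨ ℚ.*-assoc L 1/c c ⟨
  L * 1/c * c      ≤⟨ ℚ.*-monoʳ-≤-nonNeg c {{ℚ.nonNegative (ℚ.<⇒≤ 0<c)}} h ⟩
  ι N * c          ∎)
  where
  open ℚ.≤-Reasoning
  instance _ = ℚ.pos⇒nonZero c {{ℚ.positive 0<c}}
  1/c : ℚ
  1/c = ℚ.1/ c

Eventually-× : ∀ {A B : ℕ → Set} → Eventually A → Eventually B → Eventually (λ n → A n × B n)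
Eventually-× (M , f) (N , g) = M ℕ.⊔ N , λ n le → f n (ℕ.m⊔n≤o⇒m≤o M N le) , g n (ℕ.m⊔n≤o⇒n≤o M N le)

Eventually-map : ∀ {A B : ℕ → Set} → (∀ n → A n → B n) → Eventually A → Eventually B
Eventually-map h (N , f) = N , λ n le → h n (f n le)

eventually-from : ∀ N → Eventually (N ℕ.≤_)
eventually-from N = N , λ _ le → le

p≤∣p∣ : ∀ p → p ≤ ℚ.∣ p ∣
p≤∣p∣ p with ℚ.≤-total 0ℚ p
... | inj₁ 0≤p = ℚ.≤-reflexive (sym (ℚ.0≤p⇒∣p∣≡p 0≤p))
... | inj₂ p≤0 = ℚ.≤-trans p≤0 (ℚ.0≤∣p∣ p)

0<-⇒< : ∀ {a b} → 0ℚ < b - a → a < b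
0<-⇒< {a} {b} 0<b-a = subst₂ _<_ (ℚ.+-identityˡ a) (back a b) (ℚ.+-monoˡ-< a 0<b-a)
  where
  back : ∀ a b → (b - a) + a ≡ b
  back = R.solve 2 (λ a b → (b R.:- a) R.:+ a R.:= b) refl

-- Trades the real limit for a single rational approximant `seq x k`, with `k` taken so late that
-- the eventual property `A` holds there too.
approximate : ∀ a x {A : ℕ → Set} → a ⟶ x → ∀ ε → 0ℚ < ε → Eventually A →
  Eventually (λ n → ∃[ k ] A k × ℚ.∣ a n - seq x k ∣ ≤ ε)
approximate a x lim ε 0<ε ev = Eventually-map
  (λ n (ε′ , 0<ε′ , near) → let (N , h) = Eventually-× ev near; (A , b) = h N ℕ.≤-refl in
    N , A , ℚ.<⇒≤ (0<-⇒< (ℚ.<-trans 0<ε′ b)))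
  (lim ε 0<ε)

¼ : ℚ
¼ = ½ * ½

0<½* : ∀ {ε} → 0ℚ < ε → 0ℚ < ½ * ε
0<½* = 0<* (ℚ.positive⁻¹ ½)

-- Half of the gap `ε` between the approximants of `x` and 1 pays for the distance from `a n` to the
-- approximant; the other half remains as δ.
limit<1 : ∀ a x → a ⟶ x → x <ᵣ 1ᵣ → ∃[ δ ] 0ℚ < δ × Eventually (λ n → δ ≤ 1ℚ - a n)
limit<1 a x lim (ε , 0<ε , gap) = ½ * ε , 0<½* 0<ε , Eventually-map
  (λ n (k , ε<1-x , near) → ≤-by
    (0≤+ (≤⇒0≤ (ℚ.<⇒≤ ε<1-x)) (≤⇒0≤ (ℚ.≤-trans (p≤∣p∣ (a n - seq x k)) near)))
    (R.solve 3 (λ a x e → ((R.con 1ℚ R.:- x) R.:- e) R.:+ (R.con ½ R.:* e R.:- (a R.:- x))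
      R.:= (R.con 1ℚ R.:- a) R.:- R.con ½ R.:* e) refl (a n) (seq x k) ε))
  (approximate a x lim (½ * ε) (0<½* 0<ε) gap)

limit≃1 : ∀ a x → a ⟶ x → x ≃ᵣ 1ᵣ → Eventually (λ n → 1ℚ - a n ≤ ½)
limit≃1 a x lim x≃1 = Eventually-map
  (λ n (k , x-near , a-near) → ≤-by
    (0≤+ (≤⇒0≤ (ℚ.≤-trans (p≤∣p∣ (1ℚ - seq x k)) (subst (_≤ ¼) (∣-∣-comm (seq x k) 1ℚ) (ℚ.<⇒≤ x-near))))
         (≤⇒0≤ (ℚ.≤-trans (p≤∣p∣ (seq x k - a n)) (subst (_≤ ¼) (∣-∣-comm (a n) (seq x k)) a-near))))
    (R.solve 2 (λ a x → (R.con ¼ R.:- (R.con 1ℚ R.:- x)) R.:+ (R.con ¼ R.:- (x R.:- a))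
      R.:= R.con ½ R.:- (R.con 1ℚ R.:- a)) refl (a n) (seq x k)))
  (approximate a x lim ¼ 0<¼ (x≃1 ¼ 0<¼))
  where
  0<¼ : 0ℚ < ¼
  0<¼ = ℚ.positive⁻¹ ¼
  ∣-∣-comm : ∀ p r → ℚ.∣ p - r ∣ ≡ ℚ.∣ r - p ∣
  ∣-∣-comm p r = trans (sym (ℚ.∣-p∣≡∣p∣ (p - r)))
    (cong ℚ.∣_∣ (R.solve 2 (λ p r → R.:- (p R.:- r) R.:= r R.:- p) refl p r))

-- A strict inequality of reals asks for a rational margin. Requiring 1 - a n ≤ ε/2 leaves room ε/2,
-- of which ε/4 is the margin.
⟶1 : ∀ a → (∀ n → 2 ℕ.≤ n → 0ℚ ≤ 1ℚ - a n) →
  (∀ ε → 0ℚ < ε → Eventually (λ n → 1ℚ - a n ≤ ε)) → a ⟶ 1ᵣ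
⟶1 a 0≤1-a small ε 0<ε = Eventually-map
  (λ n (2≤n , 1-a≤) → ¼ * ε , 0<* (ℚ.positive⁻¹ ¼) 0<ε , 0 , λ _ _ → gap n (subst (_≤ ½ * ε) (sym (abs n 2≤n)) 1-a≤))
  (Eventually-× (eventually-from 2) (small (½ * ε) (0<½* 0<ε)))
  where
  abs : ∀ n → 2 ℕ.≤ n → ℚ.∣ a n - 1ℚ ∣ ≡ 1ℚ - a n
  abs n 2≤n = trans (sym (ℚ.∣-p∣≡∣p∣ (a n - 1ℚ)))
    (trans (cong ℚ.∣_∣ (R.solve 1 (λ a → R.:- (a R.:- R.con 1ℚ) R.:= R.con 1ℚ R.:- a) refl (a n)))
      (ℚ.0≤p⇒∣p∣≡p (0≤1-a n 2≤n)))
  gap : ∀ n → ℚ.∣ a n - 1ℚ ∣ ≤ ½ * ε → ¼ * ε < ε - ℚ.∣ a n - 1ℚ ∣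
  gap n near = ℚ.<-≤-trans
    (0<-⇒< (subst (0ℚ <_) (R.solve 1 (λ e → R.con ¼ R.:* e R.:= R.con ½ R.:* e R.:- R.con ¼ R.:* e) refl ε)
      (0<* (ℚ.positive⁻¹ ¼) 0<ε)))
    (≤-by (≤⇒0≤ near) (R.solve 2 (λ e t → R.con ½ R.:* e R.:- t R.:= (e R.:- t) R.:- R.con ½ R.:* e) refl ε ℚ.∣ a n - 1ℚ ∣))

eventually-third : ∀ N → Eventually (λ n → N ℕ.≤ n ℕ./ 3)
eventually-third N = N ℕ.* 3 , λ n le → subst (ℕ._≤ n ℕ./ 3) (ℕ.m*n/n≡m N 3) (ℕ./-monoˡ-≤ 3 le)

-- In `n≤5[n/3]` this is 3 + 2: with m = `n ℕ./ 3` ≥ 1, the remainder is at most 2 ≤ 2m.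
5ℚ : ℚ
5ℚ = 1ℚ + 1ℚ + 1ℚ + 1ℚ + 1ℚ

n≤5[n/3] : ∀ n → 1 ℕ.≤ n ℕ./ 3 → ι n ≤ 5ℚ * ι (n ℕ./ 3)
n≤5[n/3] n 1≤m = subst (ι n ≤_) (trans (ι-* 5 m) (cong (_* ι m) (sym (÷1≡ι 5)))) (ι-mono-≤ (begin
  n                       ≡⟨ ℕ.m≡m%n+[m/n]*n n 3 ⟩
  n ℕ.% 3 ℕ.+ m ℕ.* 3     ≤⟨ ℕ.+-monoˡ-≤ (m ℕ.* 3) (ℕ.≤-trans (ℕ.<⇒≤pred (ℕ.m%n<n n 3)) (ℕ.*-monoˡ-≤ 2 1≤m)) ⟩
  m ℕ.* 2 ℕ.+ m ℕ.* 3     ≡⟨ ℕ.*-distribˡ-+ m 2 3 ⟨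
  m ℕ.* 5                 ≡⟨ ℕ.*-comm m 5 ⟩
  5 ℕ.* m                 ∎))
  where
  open ℕ.≤-Reasoning
  m : ℕ
  m = n ℕ./ 3

-- The dense and the sparse regime

module Regimes (K P : ℕ) (1≤P : 1 ℕ.≤ P) (K≤P : K ℕ.≤ P) where
  open KeyRing K P 1≤P K≤P
  open Chebyshev K P 1≤P K≤P

  Large : ℚ → ℚ → Set
  Large L μ = L ≤ μ × L * p ≤ μ * μ * β × L ≤ μ * μ * μ * β

  -- From p ≥ δ follows β ≥ δ³, hence μβ ≥ L. Higher powers of μ only help since μ ≥ 1, and p ≤ 1
  -- gives the condition on `L * p`.
  dense : ∀ {L δ μ} → 0ℚ < L → 0ℚ < δ → δ ≤ p → 1ℚ ≤ μ → L ≤ μ * (δ * δ * δ) → Large L μ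
  dense {L} {δ} {μ} 0<L 0<δ δ≤p 1≤μ L≤μδ³ = L≤μ , Lp≤ , ℚ.≤-trans L≤μβ (ℚ.≤-trans μβ≤μ²β μ²β≤μ³β)
    where
    0≤δ : 0ℚ ≤ δ
    0≤δ = ℚ.<⇒≤ 0<δ
    0≤μ : 0ℚ ≤ μ
    0≤μ = ℚ.≤-trans 0≤1ℚ 1≤μ
    0≤L : 0ℚ ≤ L
    0≤L = ℚ.<⇒≤ 0<L
    grow : ∀ {t} → 0ℚ ≤ t → t ≤ μ * t
    grow {t} 0≤t = subst (_≤ μ * t) (ℚ.*-identityˡ t) (ℚ.*-monoʳ-≤-nonNeg t {{ℚ.nonNegative 0≤t}} 1≤μ)
    δ³≤p³ : δ * δ * δ ≤ p * p * p
    δ³≤p³ = *-mono-≤ (0≤* 0≤δ 0≤δ) 0≤p (*-mono-≤ 0≤δ 0≤p δ≤p δ≤p) δ≤p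
    p³≤1 : p * p * p ≤ 1ℚ
    p³≤1 = *-mono-≤ (0≤* 0≤p 0≤p) 0≤1ℚ (*-mono-≤ 0≤p 0≤1ℚ p≤1 p≤1) p≤1
    scaled : ∀ {s t} → s ≤ t → μ * s ≤ μ * t
    scaled = ℚ.*-monoˡ-≤-nonNeg μ {{ℚ.nonNegative 0≤μ}}
    L≤μ : L ≤ μ
    L≤μ = ℚ.≤-trans L≤μδ³ (ℚ.≤-trans (scaled (ℚ.≤-trans δ³≤p³ p³≤1)) (ℚ.≤-reflexive (ℚ.*-identityʳ μ)))
    L≤μβ : L ≤ μ * β
    L≤μβ = ℚ.≤-trans L≤μδ³ (scaled (ℚ.≤-trans δ³≤p³ p³≤β))
    μβ≤μ²β : μ * β ≤ μ * μ * β
    μβ≤μ²β = subst (μ * β ≤_) (sym (ℚ.*-assoc μ μ β)) (grow (0≤* 0≤μ 0≤β))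
    μ²β≤μ³β : μ * μ * β ≤ μ * μ * μ * β
    μ²β≤μ³β = ℚ.*-monoʳ-≤-nonNeg β {{ℚ.nonNegative 0≤β}} (ℚ.≤-trans (grow (0≤* 0≤μ 0≤μ)) (ℚ.≤-reflexive (sym (ℚ.*-assoc μ μ μ))))
    Lp≤ : L * p ≤ μ * μ * β
    Lp≤ = ℚ.≤-trans (ℚ.≤-trans (ℚ.*-monoˡ-≤-nonNeg L {{ℚ.nonNegative 0≤L}} p≤1) (ℚ.≤-reflexive (ℚ.*-identityʳ L)))
      (ℚ.≤-trans L≤μβ μβ≤μ²β)

  -- With R = μ³ τ and W = μ² (x² + y) one has R² ≤ W³, so W is large once R is.
  sparse : ∀ {L μ} → 1ℚ ≤ L → L ≤ μ → p ≤ ½ → 5ℚ * L * (5ℚ * L) < μ * μ * μ * τ K P → Large L μ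
  sparse {L} {μ} 1≤L L≤μ p≤½ a²<R₀ = L≤μ , Lp≤ , L≤μ³β
    where
    two : ℚ
    two = 1ℚ + 1ℚ
    a R g W : ℚ
    -- The factor 5 compensates the loss in `pg≤5β`.
    a = 5ℚ * L
    g = x * x + y
    R = μ * μ * μ * (x * g)
    W = μ * μ * g
    0≤L : 0ℚ ≤ L
    0≤L = ℚ.≤-trans 0≤1ℚ 1≤L
    0≤μ : 0ℚ ≤ μ
    0≤μ = ℚ.≤-trans 0≤L L≤μ
    0≤5 : 0ℚ ≤ 5ℚ
    0≤5 = ℚ.nonNegative⁻¹ 5ℚ
    0≤a : 0ℚ ≤ a
    0≤a = 0≤* 0≤5 0≤L
    0≤μ³ : 0ℚ ≤ μ * μ * μ
    0≤μ³ = 0≤* (0≤* 0≤μ 0≤μ) 0≤μ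
    0≤g : 0ℚ ≤ g
    0≤g = 0≤+ (0≤* 0≤x 0≤x) 0≤y
    0≤W : 0ℚ ≤ W
    0≤W = 0≤* (0≤* 0≤μ 0≤μ) 0≤g
    a²<R : a * a < R
    a²<R = subst (λ t → a * a < μ * μ * μ * t) (trans τ≡
      (R.solve 2 (λ x y → x R.:* y R.:+ x R.:* x R.:* x R.:= x R.:* (x R.:* x R.:+ y)) refl x y)) a²<R₀
    1≤a : 1ℚ ≤ a
    1≤a = ≤-by (0≤+ (0≤* 0≤5 (≤⇒0≤ 1≤L)) (ℚ.nonNegative⁻¹ (5ℚ - 1ℚ)))
      (R.solve 1 (λ l → R.con 5ℚ R.:* (l R.:- R.con 1ℚ) R.:+ R.con (5ℚ - 1ℚ) R.:= R.con 5ℚ R.:* l R.:- R.con 1ℚ) refl L)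
    -- The difference is μ⁶g²y, because g - x² = y.
    R²≤W³ : R * R ≤ W * W * W
    R²≤W³ = ≤-by (0≤* (0≤* 0≤μ³ 0≤μ³) (0≤* (0≤* 0≤g 0≤g) 0≤y))
      (R.solve 3 (λ m x y → let infixl 6 _⊕_ _⊖_; infixl 7 _⊗_ ; _⊕_ = R._:+_ ; _⊗_ = R._:*_ ; _⊖_ = R._:-_ ; g = x ⊗ x ⊕ y in
        m ⊗ m ⊗ m ⊗ (m ⊗ m ⊗ m) ⊗ (g ⊗ g ⊗ y)
        R.:= m ⊗ m ⊗ g ⊗ (m ⊗ m ⊗ g) ⊗ (m ⊗ m ⊗ g) ⊖ m ⊗ m ⊗ m ⊗ (x ⊗ g) ⊗ (m ⊗ m ⊗ m ⊗ (x ⊗ g))) refl μ x y)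
    -- Otherwise W³ ≤ a³ ≤ a⁴ < R² ≤ W³. Asking for R > a², where the power 3/2 would do, avoids
    -- roots and is affordable since a ≥ 1.
    a≤W : a ≤ W
    a≤W with ℚ.≤-total a W
    ... | inj₁ a≤W = a≤W
    ... | inj₂ W≤a = ⊥-elim (ℚ.<-irrefl refl (begin-strict
      W * W * W          ≤⟨ *-mono-≤ (0≤* 0≤W 0≤W) 0≤a (*-mono-≤ 0≤W 0≤a W≤a W≤a) W≤a ⟩
      a * a * a          ≤⟨ *-mono-≤ (0≤* 0≤a 0≤a) (0≤* 0≤a 0≤a) ℚ.≤-refl (subst (_≤ a * a) (ℚ.*-identityʳ a) (ℚ.*-monoˡ-≤-nonNeg a {{ℚ.nonNegative 0≤a}} 1≤a)) ⟩
      a * a * (a * a)    ≤⟨ ℚ.*-monoˡ-≤-nonNeg (a * a) {{ℚ.nonNegative (0≤* 0≤a 0≤a)}} (ℚ.<⇒≤ a²<R) ⟩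
      a * a * R          <⟨ ℚ.*-monoˡ-<-pos R {{ℚ.positive (ℚ.≤-<-trans (0≤* 0≤a 0≤a) a²<R)}} a²<R ⟩
      R * R              ≤⟨ R²≤W³ ⟩
      W * W * W          ∎))
      where open ℚ.≤-Reasoning
    -- From x ≤ p + p x and p ≤ 1/2 one gets x ≤ p + x/2.
    x≤2p : x ≤ two * p
    x≤2p = ≤-by (0≤+ (0≤* 0≤2 (≤⇒0≤ x≤p[1+x])) (0≤* 0≤2 (0≤* 0≤x (≤⇒0≤ p≤½))))
      (R.solve 2 (λ x p → let o = R.con 1ℚ ; t = R.con two in t R.:* (p R.:* (o R.:+ x) R.:- x) R.:+ t R.:* (x R.:* (R.con ½ R.:- p)) R.:= t R.:* p R.:- x) refl x p)
      where
      0≤2 : 0ℚ ≤ two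
      0≤2 = ℚ.nonNegative⁻¹ two
    -- Here 5 = 4 + 1: p x² ≤ 4p³ ≤ 4β and p y ≤ β.
    pg≤5β : p * g ≤ 5ℚ * β
    pg≤5β = ≤-by (0≤+ (0≤+ (0≤* (0≤* 0≤2 0≤2) (≤⇒0≤ p³≤β)) (≤⇒0≤ py≤β)) (0≤* 0≤p (0≤* (≤⇒0≤ x≤2p) (0≤+ (0≤* 0≤2 0≤p) 0≤x))))
      (R.solve 4 (λ p x y b → let t = R.con two in
        t R.:* t R.:* (b R.:- p R.:* p R.:* p) R.:+ (b R.:- p R.:* y) R.:+ p R.:* ((t R.:* p R.:- x) R.:* (t R.:* p R.:+ x))
        R.:= R.con 5ℚ R.:* b R.:- p R.:* (x R.:* x R.:+ y)) refl p x y β)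
      where
      0≤2 : 0ℚ ≤ two
      0≤2 = ℚ.nonNegative⁻¹ two
    Lp≤ : L * p ≤ μ * μ * β
    Lp≤ = cancel-≤ 5ℚ (ℚ.positive⁻¹ 5ℚ) (≤-by
      (0≤+ (0≤* 0≤p (≤⇒0≤ a≤W)) (0≤* (0≤* 0≤μ 0≤μ) (≤⇒0≤ pg≤5β)))
      (R.solve 5 (λ p l m g b → let f = R.con 5ℚ in
        p R.:* (m R.:* m R.:* g R.:- f R.:* l) R.:+ m R.:* m R.:* (f R.:* b R.:- p R.:* g)
        R.:= m R.:* m R.:* b R.:* f R.:- l R.:* p R.:* f) refl p L μ g β))
    -- The chain is 25L² < R = μ³xg ≤ 2μ³pg ≤ 10μ³β, while 25L² ≥ 10L because L ≥ 1.
    L≤μ³β : L ≤ μ * μ * μ * β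
    L≤μ³β = cancel-≤ (two * 5ℚ) (ℚ.positive⁻¹ (two * 5ℚ)) (≤-by
      (0≤+ (0≤+ (0≤+ (≤⇒0≤ (ℚ.<⇒≤ a²<R)) (0≤* 0≤μ³ (0≤* (≤⇒0≤ x≤2p) 0≤g)))
           (0≤* (0≤* 0≤2 0≤μ³) (≤⇒0≤ pg≤5β)))
           (0≤+ (0≤* 0≤25 (0≤* 0≤L (≤⇒0≤ 1≤L))) (0≤* 0≤15 0≤L)))
      (R.solve 6 (λ p x l m g b → let infixl 6 _⊕_ _⊖_; infixl 7 _⊗_ ; _⊕_ = R._:+_ ; _⊗_ = R._:*_ ; _⊖_ = R._:-_ ; f = R.con 5ℚ ; t = R.con two in
        (m ⊗ m ⊗ m ⊗ (x ⊗ g) ⊖ f ⊗ l ⊗ (f ⊗ l)) ⊕ m ⊗ m ⊗ m ⊗ ((t ⊗ p ⊖ x) ⊗ g) ⊕ t ⊗ (m ⊗ m ⊗ m) ⊗ (f ⊗ b ⊖ p ⊗ g)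
        ⊕ (R.con (5ℚ * 5ℚ) ⊗ (l ⊗ (l ⊖ R.con 1ℚ)) ⊕ R.con (5ℚ * 5ℚ - two * 5ℚ) ⊗ l)
        R.:= m ⊗ m ⊗ m ⊗ b ⊗ (t ⊗ f) ⊖ l ⊗ (t ⊗ f)) refl p x L μ g β))
      where
      0≤2 : 0ℚ ≤ two
      0≤2 = ℚ.nonNegative⁻¹ two
      0≤25 : 0ℚ ≤ 5ℚ * 5ℚ
      0≤25 = ℚ.nonNegative⁻¹ (5ℚ * 5ℚ)
      0≤15 : 0ℚ ≤ 5ℚ * 5ℚ - two * 5ℚ
      0≤15 = ℚ.nonNegative⁻¹ (5ℚ * 5ℚ - two * 5ℚ)

  Large⇒likely : ∀ n {L ε} → 0ℚ < L → 7ℚ ≤ L * ε → Large L (ι (n ℕ./ 3)) → 1ℚ - ℙ[triangle] n K P ≤ ε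
  Large⇒likely n {L} {ε} 0<L 7≤Lε (h₁ , h₂ , h₃) = ℚ.*-cancelˡ-≤-pos L {{ℚ.positive 0<L}}
    (ℚ.≤-trans (large-moments n 0<L h₁ h₂ h₃) 7≤Lε)

  -- The factor 5³ pays for replacing n³ by the cube of `n ℕ./ 3`.
  sparse-at : ∀ n {L} → 1ℚ ≤ L → 1 ℕ.≤ n ℕ./ 3 → L ≤ ι (n ℕ./ 3) → p ≤ ½ →
    5ℚ * 5ℚ * 5ℚ * (5ℚ * L * (5ℚ * L)) < ((n ^ 3) ÷ 1) * τ K P → Large L (ι (n ℕ./ 3))
  sparse-at n {L} 1≤L 1≤m L≤μ p≤½ big = sparse 1≤L L≤μ p≤½
    (ℚ.*-cancelˡ-<-nonNeg (5ℚ * 5ℚ * 5ℚ) (ℚ.<-≤-trans big (begin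
      ((n ^ 3) ÷ 1) * τ K P             ≡⟨ cong (_* τ K P) (trans (÷1≡ι (n ^ 3)) cube) ⟩
      ν * ν * ν * τ K P                 ≤⟨ *-mono-≤ (0≤* (0≤* 0≤ν 0≤ν) 0≤ν) 0≤τ
                                             (*-mono-≤ (0≤* 0≤ν 0≤ν) 0≤5μ (*-mono-≤ 0≤ν 0≤5μ ν≤5μ ν≤5μ) ν≤5μ) ℚ.≤-refl ⟩
      5ℚ * μ * (5ℚ * μ) * (5ℚ * μ) * τ K P ≡⟨ R.solve 2 (λ m t → let f = R.con 5ℚ in
           f R.:* m R.:* (f R.:* m) R.:* (f R.:* m) R.:* t R.:= f R.:* f R.:* f R.:* (m R.:* m R.:* m R.:* t)) refl μ (τ K P) ⟩
      5ℚ * 5ℚ * 5ℚ * (μ * μ * μ * τ K P) ∎)))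
    where
    open ℚ.≤-Reasoning
    ν μ : ℚ
    ν = ι n
    μ = ι (n ℕ./ 3)
    0≤ν : 0ℚ ≤ ν
    0≤ν = 0≤ι n
    ν≤5μ : ν ≤ 5ℚ * μ
    ν≤5μ = n≤5[n/3] n 1≤m
    0≤5μ : 0ℚ ≤ 5ℚ * μ
    0≤5μ = ℚ.≤-trans 0≤ν ν≤5μ
    0≤τ : 0ℚ ≤ τ K P
    0≤τ = subst (0ℚ ≤_) (sym τ≡) (0≤+ (0≤* 0≤x 0≤y) (0≤* (0≤* 0≤x 0≤x) 0≤x))
    cube : ι (n ^ 3) ≡ ν * ν * ν
    cube = trans (cong (λ z → ι (n ℕ.* (n ℕ.* z))) (ℕ.*-identityʳ n))
      (trans (ι-* n (n ℕ.* n)) (trans (cong (ν *_) (ι-* n n)) (sym (ℚ.*-assoc ν ν ν))))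

theorem3p2 : (θ : Scaling) → let open Scaling θ in
    (q⋆ : ℝ) → (λ n → q (K n) (P n)) ⟶ q⋆ →
    ((0ᵣ ≤ᵣ q⋆ × q⋆ <ᵣ 1ᵣ)
    ⊎ (q⋆ ≃ᵣ 1ᵣ × (λ n → ((n ^ 3) ÷ 1) * τ (K n) (P n)) ⟶∞)) →
    (λ n → ℙ[triangle] n (K n) (P n)) ⟶ 1ᵣ
theorem3p2 θ q⋆ lim regime = ⟶1 (λ n → ℙ[triangle] n (K n) (P n)) (λ n 2≤n → Chebyshev.0≤1-ℙ _ _ (1≤P n 2≤n) (K≤P n 2≤n) n) λ ε 0<ε →
  let (N , 7≤) = archimedean-* 7ℚ 0<ε
      L : ℕ
      -- The successor makes 1 ≤ L immediate, as `eventually-large` requires.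
      L = suc N
      7≤Lε : 7ℚ ≤ ι L * ε
      7≤Lε = ℚ.≤-trans 7≤ (ℚ.*-monoʳ-≤-nonNeg ε {{ℚ.nonNegative (ℚ.<⇒≤ 0<ε)}} (ι-mono-≤ (ℕ.n≤1+n N)))
  in Eventually-map
    (λ n (2≤n , large) → Regimes.Large⇒likely _ _ (1≤P n 2≤n) (K≤P n 2≤n) n (0<ι (s≤s z≤n)) 7≤Lε (large 2≤n))
    (Eventually-× (eventually-from 2) (eventually-large regime L (s≤s z≤n)))
  where
  open Scaling θ
  1≤P : ∀ n → 2 ℕ.≤ n → 1 ℕ.≤ P n
  1≤P n 2≤n = P-positive n (ℕ.<⇒≤ 2≤n)
  -- The proof of 2 ≤ n sits inside the predicate because `Regimes` needs K n ≤ P n, which a scaling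
  -- grants only from index 2 on.
  eventually-large : _ → ∀ L → 1 ℕ.≤ L → Eventually (λ n → (2≤n : 2 ℕ.≤ n) →
    Regimes.Large (K n) (P n) (1≤P n 2≤n) (K≤P n 2≤n) (ι L) (ι (n ℕ./ 3)))
  eventually-large (inj₁ (_ , q⋆<1)) L 1≤L =
    let (δ , 0<δ , δ≤1-q) = limit<1 (λ n → q (K n) (P n)) q⋆ lim q⋆<1
        0<δ³ = 0<* (0<* 0<δ 0<δ) 0<δ
        (N , L≤Nδ³) = archimedean-* (ι L) 0<δ³
    in Eventually-map
      (λ n (δ≤p , N<m) 2≤n → Regimes.dense _ _ (1≤P n 2≤n) (K≤P n 2≤n) (0<ι 1≤L) 0<δ δ≤p
        (1≤ι (ℕ.≤-trans (s≤s z≤n) N<m))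
        (ℚ.≤-trans L≤Nδ³ (ℚ.*-monoʳ-≤-nonNeg (δ * δ * δ) {{ℚ.nonNegative (ℚ.<⇒≤ 0<δ³)}} (ι-mono-≤ (ℕ.<⇒≤ N<m)))))
      (Eventually-× δ≤1-q (eventually-third (suc N)))
  eventually-large (inj₂ (q⋆≃1 , n³τ⟶∞)) L 1≤L = Eventually-map
    (λ n (p≤½ , big , L≤m) 2≤n → Regimes.sparse-at _ _ (1≤P n 2≤n) (K≤P n 2≤n) n
      (1≤ι 1≤L) (ℕ.≤-trans 1≤L L≤m) (ι-mono-≤ L≤m) p≤½ big)
    (Eventually-× (limit≃1 (λ n → q (K n) (P n)) q⋆ lim q⋆≃1)
      (Eventually-× (n³τ⟶∞ (5ℚ * 5ℚ * 5ℚ * (5ℚ * ι L * (5ℚ * ι L)))) (eventually-third L)))
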